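{- $\text{U}\exists\forall\text{ -Sat}\in\mathbf{D_2^P}$ and $\text{WDom-Strategy}\in\mathbf{D_2^P}$.
   Context: $\Vert$ denotes concatenation of bit strings; circuit outputs are compared as binary numbers. $\mathbf{D_2^P}=\{L_1\cap L_2: L_1\in\mathbf{\Sigma_2^P},\ L_2\in\mathbf{\Pi_2^P}\}$. U$\exists\forall$-Sat: the input consists of two sets $\mathcal{X}=\{x_1,\dots,x_n\}$ and $\mathcal{Y}=\{y_1,\dots,y_n\}$ of Boolean variables and a Boolean formula $\psi$ over $\mathcal{X}\cup\mathcal{Y}$; the question is whether there is exactly one $x^*\in\{0,1\}^n$ such that for all $y'\in\{0,1\}^n$ we have $\psi(x^*\Vert y')=1$. WDom-Strategy (Weak-Dominant-Strategy): the input is a Boolean circuit $C\colon\{0,1\}^{2n}\to\{0,1\}^n$; the question is whether there exists $x\in\{0,1\}^n$ such that for all $x',y\in\{0,1\}^n$ with $x'\neq x$ there exists $y'\in\{0,1\}^n$ with $C(x\Vert y)\geq C(x'\Vert y)$ and $C(x\Vert y')>C(x'\Vert y')$. -}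

module Defs where

open import Data.Bool using (Bool; true; false; not; _∧_; _∨_; if_then_else_; T)
open import Data.Fin using (Fin; toℕ)
open import Data.List as List using (List; []; _∷_; length; replicate) renaming (_++_ to _⁀_)
open import Data.Maybe using (Maybe; just; nothing; maybe′)
open import Data.Nat using (ℕ; zero; suc; _+_; _*_; _≥_; _>_)
open import Data.Product using (Σ; ∃-syntax; ∃!; _×_; _,_)
open import Data.Vec as Vec using (Vec; []; _∷_; _++_; lookup; toList)
open import Function.Bundles using (_↔_; _⇔_)
open import Level using (0ℓ) renaming (suc to lsuc)
open import Relation.Binary.PropositionalEquality using (_≡_; _≢_)
open import Relation.Unary using (Pred; _∈_; _∩_; _≐_)

Word : Set
Word = List Bool

Language : Set₁
Language = Pred Word 0ℓ

-- Polynomials serve only as upper bounds and certificate lengths, so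
-- natural-number coefficients suffice.
infixl 6 _⊕_
infixl 7 _⊗_

data Poly : Set where
  con     : ℕ → Poly
  X       : Poly
  _⊕_ _⊗_ : Poly → Poly → Poly

⟦_⟧ : Poly → ℕ → ℕ
⟦ con c ⟧ n = c
⟦ X ⟧     n = n
⟦ p ⊕ q ⟧ n = ⟦ p ⟧ n + ⟦ q ⟧ n
⟦ p ⊗ q ⟧ n = ⟦ p ⟧ n * ⟦ q ⟧ n

data Symbol (s : ℕ) : Set where
  blank : Symbol s
  bit   : Bool → Symbol s
  aux   : Fin s → Symbol s

data Move : Set where
  L S R : Move

-- A two-way infinite tape.  Both lists are ordered outwards from the
-- scanned cell, and all cells beyond their ends are blank.
record Tape (s : ℕ) : Set where
  constructor tape
  field
    left  : List (Symbol s)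
    head  : Symbol s
    right : List (Symbol s)

open Tape public

module _ {s : ℕ} where

  move : Move → Tape s → Tape s
  move L (tape []      h r)       = tape [] blank (h ∷ r)
  move L (tape (x ∷ l) h r)       = tape l x (h ∷ r)
  move S t                        = t
  move R (tape l       h [])      = tape (h ∷ l) blank []
  move R (tape l       h (x ∷ r)) = tape (h ∷ l) x r

  act : Symbol s × Move → Tape s → Tape s
  act (a , d) t = move d (record t { head = a })

  load : Word → Tape s
  load []      = tape [] blank []
  load (b ∷ w) = tape [] (bit b) (List.map bit w)

-- A machine with m input tapes and some number of work tapes.  It halts on
-- entering a state q with halt q ≡ just b: it accepts if b is true and
-- rejects if b is false.
record TM (m : ℕ) : Set₁ where
  field
    work    : ℕ
    symbols : ℕ
    State   : Set
    finite  : ∃[ n ] (State ↔ Fin n)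
    start   : State
    halt    : State → Maybe Bool
    δ       : State → Vec (Symbol symbols) (m + work) →
              State × Vec (Symbol symbols × Move) (m + work)

record Config {m} (M : TM m) : Set where
  constructor config
  open TM M
  field
    state : State
    tapes : Vec (Tape symbols) (m + work)

open Config public

module _ {m} (M : TM m) where
  open TM M

  next : Config M → Config M
  next (config q ts) =
    let q′ , as = δ q (Vec.map head ts) in
    config q′ (Vec.zipWith act as ts)

  step : Config M → Config M
  step c = maybe′ (λ _ → c) (next c) (halt (state c))

  run : ℕ → Config M → Config M
  run zero    c = c
  run (suc t) c = run t (step c)

  initial : Vec Word m → Config M
  initial ws = config start (Vec.map load ws ++ Vec.replicate work (load []))

size : ∀ {m} → Vec Word m → ℕ
size ws = Vec.sum (Vec.map length ws)

-- Halted configurations are fixed by step, so the equation says that M halts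
-- with answer f ws after at most ⟦ p ⟧ (size ws) steps.
PolyTime : ∀ {m} → (Vec Word m → Bool) → Set₁
PolyTime {m} f =
  Σ (TM m) λ M → ∃[ p ] ∀ ws →
  TM.halt M (state (run M (⟦ p ⟧ (size ws)) (initial M ws))) ≡ just (f ws)

-- The arguments of the polynomial-time predicate are given on separate input
-- tapes instead of being packed into one word by a pairing function.
Σ₂ᴾ : Pred Language (lsuc 0ℓ)
Σ₂ᴾ A =
  Σ (Vec Word 3 → Bool) λ f → PolyTime f × ∃[ q ] ∀ w →
    w ∈ A ⇔ (Σ (Vec Bool (⟦ q ⟧ (length w))) λ u →
             (v : Vec Bool (⟦ q ⟧ (length w))) →
             T (f (w ∷ toList u ∷ toList v ∷ [])))

Π₂ᴾ : Pred Language (lsuc 0ℓ)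
Π₂ᴾ A =
  Σ (Vec Word 3 → Bool) λ f → PolyTime f × ∃[ q ] ∀ w →
    w ∈ A ⇔ ((u : Vec Bool (⟦ q ⟧ (length w))) →
             Σ (Vec Bool (⟦ q ⟧ (length w))) λ v →
             T (f (w ∷ toList u ∷ toList v ∷ [])))

D₂ᴾ : Pred Language (lsuc 0ℓ)
D₂ᴾ A = Σ Language λ A₁ → Σ Language λ A₂ →
  A₁ ∈ Σ₂ᴾ × A₂ ∈ Π₂ᴾ × A ≐ (A₁ ∩ A₂)

-- Words that encode no instance are no-instances.
⟨_∣_⟩ : {I : Set} → (I → Word) → Pred I 0ℓ → Language
⟨ encode ∣ Yes ⟩ w = ∃[ i ] (encode i ≡ w × Yes i)

pattern O = false
pattern I = true

-- Numbers are written in unary.  The numbers occurring in an instance are at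
-- most linear in the number of its variables, respectively wires, so this is
-- polynomially equivalent to writing them in binary.
unary : ℕ → Word
unary n = replicate n I ⁀ (O ∷ [])

data Formula (n : ℕ) : Set where
  var     : Fin n → Formula n
  const   : Bool → Formula n
  neg     : Formula n → Formula n
  and or  : Formula n → Formula n → Formula n

evalF : ∀ {n} → Formula n → Vec Bool n → Bool
evalF (var i)   ρ = lookup ρ i
evalF (const b) ρ = b
evalF (neg φ)   ρ = not (evalF φ ρ)
evalF (and φ ψ) ρ = evalF φ ρ ∧ evalF ψ ρ
evalF (or φ ψ)  ρ = evalF φ ρ ∨ evalF ψ ρ

-- Reverse Polish notation over a prefix-free code for the symbols.
encodeF : ∀ {n} → Formula n → Word
encodeF (const b) = O ∷ O ∷ b ∷ []
encodeF (neg φ)   = encodeF φ ⁀ (O ∷ I ∷ [])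
encodeF (and φ ψ) = encodeF φ ⁀ encodeF ψ ⁀ (I ∷ O ∷ O ∷ [])
encodeF (or φ ψ)  = encodeF φ ⁀ encodeF ψ ⁀ (I ∷ O ∷ I ∷ [])
encodeF (var i)   = I ∷ I ∷ unary (toℕ i)

-- The variables of ψ are numbered x₁, …, xₙ, y₁, …, yₙ.
SatInstance : Set
SatInstance = Σ ℕ λ n → Formula (n + n)

encodeSat : SatInstance → Word
encodeSat (n , ψ) = unary n ⁀ encodeF ψ

UniqueSat : Pred SatInstance 0ℓ
UniqueSat (n , ψ) =
  ∃! _≡_ λ (x : Vec Bool n) → (y : Vec Bool n) → evalF ψ (x ++ y) ≡ true

U∃∀-Sat : Language
U∃∀-Sat = ⟨ encodeSat ∣ UniqueSat ⟩

data Gate (w : ℕ) : Set where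
  const   : Bool → Gate w
  neg     : Fin w → Gate w
  and or  : Fin w → Fin w → Gate w

-- Gates v w takes v wires to w wires.  Every gate may read all earlier wires,
-- any number of times; its output becomes wire 0 and the older wires are
-- shifted up by one.
data Gates : ℕ → ℕ → Set where
  []  : ∀ {w} → Gates w w
  _∷_ : ∀ {v w} → Gate v → Gates (suc v) w → Gates v w

record Circuit (i o : ℕ) : Set where
  constructor circuit
  field
    {wires} : ℕ
    gates   : Gates i wires
    outputs : Vec (Fin wires) o

evalG : ∀ {w} → Gate w → Vec Bool w → Bool
evalG (const b) ρ = b
evalG (neg i)   ρ = not (lookup ρ i)
evalG (and i j) ρ = lookup ρ i ∧ lookup ρ j
evalG (or i j)  ρ = lookup ρ i ∨ lookup ρ j

evalGs : ∀ {v w} → Gates v w → Vec Bool v → Vec Bool w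
evalGs []       ρ = ρ
evalGs (g ∷ gs) ρ = evalGs gs (evalG g ρ ∷ ρ)

evalC : ∀ {i o} → Circuit i o → Vec Bool i → Vec Bool o
evalC (circuit gs os) ρ = Vec.map (lookup (evalGs gs ρ)) os

-- Most significant bit first.
value : ∀ {n} → Vec Bool n → ℕ
value = Vec.foldl (λ _ → ℕ) (λ a b → 2 * a + (if b then 1 else 0)) 0

encodeG : ∀ {w} → Gate w → Word
encodeG (const b) = O ∷ O ∷ b ∷ []
encodeG (neg i)   = O ∷ I ∷ unary (toℕ i)
encodeG (and i j) = I ∷ O ∷ O ∷ unary (toℕ i) ⁀ unary (toℕ j)
encodeG (or i j)  = I ∷ O ∷ I ∷ unary (toℕ i) ⁀ unary (toℕ j)

-- The gate list is terminated by the otherwise unused code I ∷ I.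
encodeGs : ∀ {v w} → Gates v w → Word
encodeGs []       = I ∷ I ∷ []
encodeGs (g ∷ gs) = encodeG g ⁀ encodeGs gs

encodeOs : ∀ {w o} → Vec (Fin w) o → Word
encodeOs []       = []
encodeOs (i ∷ is) = unary (toℕ i) ⁀ encodeOs is

CircuitInstance : Set
CircuitInstance = Σ ℕ λ n → Circuit (n + n) n

encodeCircuit : CircuitInstance → Word
encodeCircuit (n , circuit gs os) = unary n ⁀ encodeGs gs ⁀ encodeOs os

WeaklyDominant : Pred CircuitInstance 0ℓ
WeaklyDominant (n , C) =
  Σ (Vec Bool n) λ x → (x′ y : Vec Bool n) → x′ ≢ x →
  Σ (Vec Bool n) λ y′ →
    out x y ≥ out x′ y × out x y′ > out x′ y′
  where
  out : Vec Bool n → Vec Bool n → ℕ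
  out a b = value (evalC C (a ++ b))

WDom-Strategy : Language
WDom-Strategy = ⟨ encodeCircuit ∣ WeaklyDominant ⟩

{-# OPTIONS --safe #-}

-- Both problems ask whether exactly one x satisfies R(x, y, z) for all y and z,
-- where R is decidable in polynomial time.  For WDom-Strategy, R says that
-- C(x ‖ y) ≥ C(z ‖ y): strategies that are never worse than any other all have
-- the same payoffs, so weak dominance means being the only such strategy.
-- Existence is a Σ₂ property.  Uniqueness is a Π₂ property: for all x ≠ x′ there
-- are y and z such that R fails for x or for x′; a further bit c says for which.
-- The same computation therefore serves both parts: with u = (x, x′) and
-- v = (c, y, z), scan the input word once and evaluate R for x or x′ as selected
-- by c.  (For existence this asks for two solutions x and x′, possibly equal.)
module Submission where

open import Data.Bool using (Bool; not; _∧_; _∨_; _xor_; if_then_else_; T)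
open import Data.Bool.Properties using (T-≡; _≟_)
open import Data.Empty using (⊥-elim)
open import Data.Fin using (Fin; zero; suc; toℕ)
open import Data.Fin.Patterns
open import Data.Fin.Properties using (*↔×; 2↔Bool)
open import Data.Fin.Subset.Properties using (anySubset?)
open import Data.List as List using (List; []; _∷_; length; replicate; _ʳ++_) renaming (_++_ to _⁀_)
open import Data.List.Properties
  using (++-assoc; ++-identityʳ; length-++; length-replicate; length-reverse; reverse-map; ʳ++-ʳ++)
open import Data.Maybe as Maybe using (Maybe; just; nothing; maybe′; is-nothing)
open import Data.Nat using (ℕ; zero; suc; _+_; _*_; _∸_; _≤_; _<_; _≥_; _>_; z≤n; s≤s)
open import Data.Nat.Properties hiding (_≟_)
open import Data.Nat.Tactic.RingSolver using (solve-∀)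
open import Data.Product using (Σ; ∃-syntax; ∃!; _×_; _,_; proj₁; proj₂)
open import Data.Product.Function.NonDependent.Propositional using (_×-↔_)
open import Data.Sum using (_⊎_; inj₁; inj₂)
open import Data.Unit using (tt)
open import Data.Vec as Vec using (Vec; []; _∷_; _++_; lookup; toList; zipWith; _[_]≔_)
open import Data.Vec.Properties using (≡-dec; length-toList; reverse-involutive; toList-reverse)
open import Data.Vec.Relation.Binary.Pointwise.Inductive using (Pointwise; []; _∷_)
open import Function.Base using (id; _∘_)
open import Function.Bundles using (_↔_; _⇔_; mk⇔; Equivalence)
open import Function.Construct.Composition using (_↔-∘_)
open import Function.Construct.Identity using (↔-id)
open import Function.Construct.Symmetry using (↔-sym)
open import Level using (0ℓ)
open import Relation.Binary.PropositionalEquality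
open import Relation.Nullary using (yes; no)
open import Relation.Unary using (Pred; _∈_)
open import Defs

-- Membership needs an explicit Turing machine with a time bound on all triples of words, however
-- malformed. Most of the work therefore happens on an intermediate stack machine, whose runs can be
-- verified by computation. Its memory stores pairs of bits, the values under x ‖ y and under z ‖ y,
-- so that one scan evaluates both and payoffs are compared bit by bit as the outputs arrive. Unary
-- indices are looked up by shifting the memory aside, at a cost linear in the index, which keeps
-- the whole run linear. The parsers are written with the recursion of the machine, so that
-- correctness of a run is an induction along the parser, and rejection of ill-formed words becomes
-- a statement about the parser alone.

-- Stack machines and their simulation by multitape Turing machines.

data Letter : Set where
  bit  : Bool → Letter
  pair : Bool → Bool → Letter

symbol : Letter → Symbol 4
symbol (bit b)    = bit b
symbol (pair O O) = aux 0F
symbol (pair O I) = aux 1F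
symbol (pair I O) = aux 2F
symbol (pair I I) = aux 3F

letter : Symbol 4 → Maybe Letter
letter blank    = nothing
letter (bit b)  = just (bit b)
letter (aux 0F) = just (pair O O)
letter (aux 1F) = just (pair O I)
letter (aux 2F) = just (pair I O)
letter (aux 3F) = just (pair I I)

letter-symbol : ∀ l → letter (symbol l) ≡ just l
letter-symbol (bit b)    = refl
letter-symbol (pair O O) = refl
letter-symbol (pair O I) = refl
letter-symbol (pair I O) = refl
letter-symbol (pair I I) = refl

Stack : Set
Stack = List Letter

-- A step first pops the stacks selected by pops and then pushes; a stack that is
-- empty or not selected is seen by react as nothing.
record StackMachine (m : ℕ) : Set₁ where
  field
    extra  : ℕ
    State  : Set
    finite : ∃[ n ] (State ↔ Fin n)
    start  : State
    halt   : State → Maybe Bool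
    pops   : State → Vec Bool (m + extra)
    react  : State → Vec (Maybe Letter) (m + extra) →
             State × Vec (Maybe Letter) (m + extra)

popped : Bool → Stack → Maybe Letter
popped O s = nothing
popped I s = List.head s

rest : Bool → Stack → Stack
rest O s = s
rest I s = List.drop 1 s

push : Maybe Letter → Stack → Stack
push nothing  s = s
push (just l) s = l ∷ s

module _ {m} (M : StackMachine m) where
  open StackMachine M

  advance : State → Vec Stack (m + extra) → State × Vec Stack (m + extra)
  advance q ss =
    let q′ , ps = react q (zipWith popped (pops q) ss) in
    q′ , zipWith push ps (zipWith rest (pops q) ss)

  -- The number is only an upper bound: `stop` fits any n, so branches of different length are
  -- padded by `later`. The condition in `tick` computes to the unit type at a concrete state, so
  -- the runs below need not supply it.
  data Yields : ℕ → State → Vec Stack (m + extra) → Bool → Set where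
    stop : ∀ {n q ss b} → halt q ≡ just b → Yields n q ss b
    tick : ∀ {n q ss b} {_ : T (is-nothing (halt q))} →
           Yields n (proj₁ (advance q ss)) (proj₂ (advance q ss)) b → Yields (suc n) q ss b

  later : ∀ k {n q ss b} → Yields n q ss b → Yields (k + n) q ss b
  later k (stop h) = stop h
  later k (tick {n} {_} {_} {_} {h} y) rewrite +-suc k n = tick {_} {_} {_} {_} {h} (later k y)

  inputs : Vec Word m → Vec Stack (m + extra)
  inputs ws = Vec.map (List.map bit) ws ++ Vec.replicate extra []

-- A stack lies to the right of the head of its tape; the scanned cell and
-- the cells to the left of it hold garbage.
Holds : Tape 4 → Stack → Set
Holds t s = right t ≡ List.map symbol s

right-moveL : (t : Tape 4) → right (move L t) ≡ head t ∷ right t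
right-moveL (tape []      h r) = refl
right-moveL (tape (_ ∷ _) h r) = refl

-- A nonempty word is loaded with its first letter scanned, so one step left brings all of it to the
-- right of the head. On an empty word that step would put a blank there, which is the symbol of no
-- letter.
home : Symbol 4 → Symbol 4 × Move
home blank = blank , S
home a     = a , L

seek : Bool → Symbol 4 → Symbol 4 × Move
seek O a = a , S
seek I a = a , R

read : Bool → Symbol 4 → Maybe Letter
read O a = nothing
read I a = letter a

-- After a pop the scanned cell is the old top, otherwise it was garbage before; in both cases it
-- may be overwritten, and the move left makes the new letter the top.
write : Maybe Letter → Symbol 4 → Symbol 4 × Move
write nothing  a = a , S
write (just l) a = symbol l , L

module Simulation {m} (M : StackMachine m) where
  open StackMachine M

  -- Phase 0 applies `home` once; phases 1 and 2 then alternate between popping and pushing, two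
  -- steps for each step of the stack machine. Only phase 1 can halt.
  turing : TM m
  turing = record
    { work    = extra
    ; symbols = 4
    ; State   = Fin 3 × State
    ; finite  = _ , ↔-sym *↔× ↔-∘ (↔-id _ ×-↔ proj₂ finite)
    ; start   = 0F , start
    ; halt    = λ { (1F , q) → halt q ; _ → nothing }
    ; δ       = δ
    }
    where
    δ : Fin 3 × State → Vec (Symbol 4) (m + extra) →
        (Fin 3 × State) × Vec (Symbol 4 × Move) (m + extra)
    δ (0F , q) as = (1F , q) , Vec.map home as
    δ (1F , q) as = (2F , q) , zipWith seek (pops q) as
    δ (2F , q) as =
      let q′ , ps = react q (zipWith read (pops q) as) in
      (1F , q′) , zipWith write ps as

  act-seek : ∀ b {t s} → Holds t s →
             let t′ = act (seek b (head t)) t in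
             Holds t′ (rest b s) × read b (head t′) ≡ popped b s
  act-seek O h = h , refl
  act-seek I {tape l a []}      {[]}    refl = refl , refl
  act-seek I {tape l a (_ ∷ _)} {x ∷ s} refl = refl , letter-symbol x

  act-write : ∀ p {t s} → Holds t s → Holds (act (write p (head t)) t) (push p s)
  act-write nothing  h = h
  act-write (just l) {t} h = trans (right-moveL (record t { head = symbol l })) (cong (_ ∷_) h)

  acts-seek : ∀ {k} (bs : Vec Bool k) {ts ss} → Pointwise Holds ts ss →
              let ts′ = zipWith act (zipWith seek bs (Vec.map head ts)) ts in
              Pointwise Holds ts′ (zipWith rest bs ss) ×
              zipWith read bs (Vec.map head ts′) ≡ zipWith popped bs ss
  acts-seek []       []       = [] , refl
  acts-seek (b ∷ bs) (h ∷ hs) =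
    let h′ , e = act-seek b h ; hs′ , es = acts-seek bs hs in
    h′ ∷ hs′ , cong₂ _∷_ e es

  acts-write : ∀ {k} (ps : Vec (Maybe Letter) k) {ts ss} → Pointwise Holds ts ss →
               Pointwise Holds (zipWith act (zipWith write ps (Vec.map head ts)) ts)
                               (zipWith push ps ss)
  acts-write []       []       = []
  acts-write (p ∷ ps) (h ∷ hs) = act-write p h ∷ acts-write ps hs

  run-halted : ∀ n {c b} → TM.halt turing (state c) ≡ just b →
               TM.halt turing (state (run turing n c)) ≡ just b
  run-halted zero    h = h
  run-halted (suc n) h rewrite h = run-halted n h

  run-yields : ∀ {n q ts ss b} → Pointwise Holds ts ss → Yields M n q ss b →
               TM.halt turing (state (run turing (n * 2) (config (1F , q) ts))) ≡ just b
  run-yields {n} hs (stop h) = run-halted (n * 2) h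
  run-yields {suc n} {q} hs (tick {_} {_} {_} {_} {live} y) with halt q
  -- The second half step reacts to the scanned symbols; `es` identifies them with the popped
  -- letters on which `advance` reacts.
  ... | nothing with hs′ , es ← acts-seek (pops q) hs
    rewrite sym es = run-yields (acts-write (proj₂ (react q _)) hs′) y

  home-load : ∀ w → Holds (act (home (head (load {4} w))) (load w)) (List.map bit w)
  home-load []      = refl
  home-load (b ∷ w) = cong (bit b ∷_) (go w)
    where
    go : ∀ w → List.map bit w ≡ List.map symbol (List.map bit w)
    go []      = refl
    go (b ∷ w) = cong (bit b ∷_) (go w)

  run-initial : ∀ n ws {b} → Yields M n start (inputs M ws) b →
                TM.halt turing (state (run turing (1 + n * 2) (initial turing ws))) ≡ just b
  run-initial n ws = run-yields (hold ws)
    where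
    blanks : ∀ k → Pointwise Holds
      (zipWith act (Vec.map home (Vec.map head (Vec.replicate k (load [])))) (Vec.replicate k (load [])))
      (Vec.replicate k [])
    blanks zero    = []
    blanks (suc k) = refl ∷ blanks k

    hold : ∀ {j} (ws : Vec Word j) →
      let ts = Vec.map load ws ++ Vec.replicate extra (load []) in
      Pointwise Holds (zipWith act (Vec.map home (Vec.map head ts)) ts)
                      (Vec.map (List.map bit) ws ++ Vec.replicate extra [])
    hold []       = blanks extra
    hold (w ∷ ws) = home-load w ∷ hold ws

  polyTime : ∀ p (f : Vec Word m → Bool) →
             (∀ ws → Yields M (⟦ p ⟧ (size ws)) start (inputs M ws) (f ws)) →
             PolyTime f
  polyTime p f e = turing , con 1 ⊕ p ⊗ con 2 , λ ws → run-initial (⟦ p ⟧ (size ws)) ws (e ws)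

-- The program of the stack machine.

-- The input tapes, followed by: the values of the variables or wires, the part
-- of mem moved aside while an index is read, an evaluation stack, a counter for
-- n, and a stack that is nonempty iff x ≠ x′.
pattern inp = 0F
pattern crt = 1F
pattern wit = 2F
pattern mem = 3F
pattern buf = 4F
pattern val = 5F
pattern cnt = 6F
pattern dif = 7F

-- A product of finite types makes finiteness immediate. The patterns name the codes of actual
-- control states; every unnamed code rejects.
Control : Set
Control = Fin 3 × Fin 8 × Bool × Bool

pattern choose      = 0F , 0F , O , O
pattern count c     = 0F , 1F , c , O
pattern first c     = 0F , 2F , c , O
pattern second c x  = 0F , 3F , c , x
pattern emit d r    = 0F , 4F , d , r
pattern finish r    = 0F , 5F , r , O
pattern judge r     = 0F , 6F , r , O
pattern halted b    = 0F , 7F , b , O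
pattern decode      = 1F , 0F , O , O
pattern decodeO     = 1F , 1F , O , O
pattern decodeI     = 1F , 2F , O , O
pattern decodeOO    = 1F , 3F , O , O
pattern decodeIO    = 1F , 4F , O , O
pattern result      = 1F , 5F , O , O
pattern alone r     = 1F , 6F , r , O
pattern negate      = 2F , 0F , O , O
pattern binary₁ o   = 2F , 1F , o , O
pattern binary₂ o   = 2F , 2F , o , O
pattern operand o   = 2F , 3F , o , O
pattern store       = 2F , 4F , O , O
pattern compare d r = 2F , 5F , d , r

-- Besides running, a control state q can be suspended: in fetch q an index is
-- read from the input while the memory is shifted onto the buffer, and in
-- restore q the buffer is shifted back.
pattern running q = 0F , q
pattern fetch q   = 1F , q
pattern restore q = 2F , q

onBit : ∀ {A : Set} → Maybe Letter → (Bool → A) → A → A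
onBit (just (bit b)) f z = f b
onBit _              f z = z

onPair : ∀ {A : Set} → Maybe Letter → (Bool → Bool → A) → A → A
onPair (just (pair a b)) f z = f a b
onPair _                 f z = z

asBit : Maybe Letter → Bool
asBit l = onBit l id O

connective : Bool → Bool → Bool → Bool
connective O = _∧_
connective I = _∨_

-- `circuits` selects the grammar: a formula is evaluated on the stack `val`, while every gate of a
-- circuit pushes its value onto `mem`, as the new wire 0. `verdict` combines the equality of x and
-- x′ with the value of R.
module Program (circuits : Bool) (verdict : Bool → Bool → Bool) where

  State : Set
  State = Fin 3 × Control

  only : Fin 8 → Vec Bool 8
  only i = Vec.replicate 8 O [ i ]≔ I

  none : Vec (Maybe Letter) 8
  none = Vec.replicate 8 nothing

  halt : State → Maybe Bool
  halt (running (halted b)) = just b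
  halt _                    = nothing

  pops : State → Vec Bool 8
  pops (running choose)        = only wit
  pops (running (count c))     = only inp
  pops (running (first c))     = only crt [ wit ]≔ I
  pops (running (second c x))  = only crt [ wit ]≔ I
  pops (running (emit d r))    = only cnt
  pops (running (finish r))    = only inp
  pops (running (judge r))     = only dif
  pops (running decode)        = only inp
  pops (running decodeO)       = only inp
  pops (running decodeI)       = only inp
  pops (running decodeOO)      = only inp
  pops (running decodeIO)      = only inp
  pops (running result)        = only val
  pops (running (alone r))     = only val
  pops (running negate)        = only val
  pops (running (binary₁ o))   = only val
  pops (running (binary₂ o))   = only val [ buf ]≔ I
  pops (running store)         = only val
  pops (running (compare d r)) = only val
  pops (running _)             = Vec.replicate 8 O
  pops (fetch q)               = only inp [ mem ]≔ I
  pops (restore q)             = only buf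

  goto : Control → State × Vec (Maybe Letter) 8
  goto q = running q , none

  done : Control
  done = if circuits then store else decode

  react : State → Vec (Maybe Letter) 8 → State × Vec (Maybe Letter) 8
  react (running choose) h = goto (count (asBit (lookup h wit)))
  react (running (count c)) h =
    onBit (lookup h inp) (λ b → if b then goto (first c) else restore decode , none) (goto (halted O))
  react (running (first c)) h =
    let x = asBit (lookup h crt) ; y = asBit (lookup h wit) in
    -- The bit of y enters both coordinates, since the two evaluations are at x ‖ y and z ‖ y.
    -- Pushing it at once leaves y reversed, which is harmless as y is quantified.
    running (second c x) , none [ mem ]≔ just (pair y y)
  react (running (second c x)) h =
    let x′ = asBit (lookup h crt) ; z = asBit (lookup h wit) in
    -- The other half waits on the buffer: moving it back later puts it above y and in the order in
    -- which it was read.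
    running (count c) ,
    none [ buf ]≔ just (pair (if c then x′ else x) z)
         [ cnt ]≔ just (bit I)
         [ dif ]≔ (if x xor x′ then just (bit I) else nothing)
  react (running (emit d r)) h =
    -- Each output consumes a letter of the counter, so exactly n outputs are read.
    maybe′ (λ _ → fetch (compare d r) , none) (goto (finish r)) (lookup h cnt)
  react (running (finish r)) h =
    maybe′ (λ _ → goto (halted O)) (goto (judge r)) (lookup h inp)
  react (running (judge r)) h = goto (halted (verdict (is-nothing (lookup h dif)) r))
  react (running decode) h =
    onBit (lookup h inp) (λ b → goto (if b then decodeI else decodeO))
      (goto (if circuits then halted O else result))
  react (running decodeO) h =
    onBit (lookup h inp)
      (λ b → if b then (if circuits then fetch negate else running negate) , none
             else goto decodeOO)
      (goto (halted O))
  react (running decodeI) h =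
    onBit (lookup h inp)
      (λ b → if b then (if circuits then running (emit O I) else fetch decode) , none
             else goto decodeIO)
      (goto (halted O))
  react (running decodeOO) h =
    onBit (lookup h inp)
      (λ b → running done , none [ val ]≔ just (pair b b)) (goto (halted O))
  react (running decodeIO) h =
    onBit (lookup h inp)
      (λ o → (if circuits then fetch (operand o) else running (binary₁ o)) , none)
      (goto (halted O))
  react (running result) h = onPair (lookup h val) (λ a b → goto (alone a)) (goto (halted O))
  react (running (alone r)) h =
    maybe′ (λ _ → goto (halted O)) (goto (judge r)) (lookup h val)
  react (running negate) h =
    onPair (lookup h val)
      (λ a b → running done , none [ val ]≔ just (pair (not a) (not b)))
      (goto (halted O))
  react (running (binary₁ o)) h =
    -- A step sees one letter of each stack, so the right operand waits on the buffer while the left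
    -- one is popped.
    maybe′ (λ l → running (binary₂ o) , none [ buf ]≔ just l) (goto (halted O)) (lookup h val)
  react (running (binary₂ o)) h =
    onPair (lookup h val)
      (λ a b → onPair (lookup h buf)
        (λ a′ b′ → running done , none [ val ]≔ just (pair (connective o a a′) (connective o b b′)))
        (goto (halted O)))
      (goto (halted O))
  react (running (operand o)) h = fetch (binary₁ o) , none
  react (running store) h = running decode , none [ mem ]≔ lookup h val
  react (running (compare d r)) h =
    onPair (lookup h val)
      (λ a b → goto (emit (d ∨ (a xor b)) (if d ∨ not (a xor b) then r else a)))
      (goto (halted O))
  react (running q) h = goto (halted O)
  react (fetch q) h =
    maybe′ (λ l → onBit (lookup h inp)
        (λ b → if b then fetch q , none [ buf ]≔ just l
               else restore q , none [ mem ]≔ just l [ val ]≔ just l)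
        (goto (halted O)))
      (goto (halted O)) (lookup h mem)
  react (restore q) h =
    maybe′ (λ l → restore q , none [ mem ]≔ just l) (goto q) (lookup h buf)

  machine : StackMachine 3
  machine = record
    { extra  = 5
    ; State  = State
    ; finite = _ , ↔-sym code
    ; start  = running choose
    ; halt   = halt
    ; pops   = pops
    ; react  = react
    }
    where
    code : Fin (3 * (3 * (8 * (2 * 2)))) ↔ State
    code = (↔-id _ ×-↔ ((↔-id _ ×-↔ ((↔-id _ ×-↔ ((2↔Bool ×-↔ 2↔Bool) ↔-∘ *↔×)) ↔-∘ *↔×)) ↔-∘ *↔×)) ↔-∘ *↔×

  Runs : ℕ → State → Vec Stack 8 → Bool → Set
  Runs = Yields machine

-- Reading the header and the certificates.

bits : Word → Stack
bits = List.map bit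

data Header : Word → Set where
  bare : ∀ n → Header (replicate n I)
  full : ∀ n w → Header (unary n ⁀ w)

header : ∀ w → Header w
header []      = bare 0
header (O ∷ w) = full 0 w
header (I ∷ w) with header w
... | bare n   = bare (suc n)
... | full n w = full (suc n) w

header-unary : ∀ n w → header (unary n ⁀ w) ≡ full n w
header-unary zero    w = refl
header-unary (suc n) w rewrite header-unary n w = refl

-- A word u represents the pair evens n u, odds n u.  The machine reads off x, x′
-- from u, and c, y (in reverse order), z from v.
first-bit : Word → Bool
first-bit []      = O
first-bit (b ∷ _) = b

evens odds : ∀ n → Word → Vec Bool n
evens zero    w = []
evens (suc n) w = first-bit w ∷ evens n (List.drop 2 w)
odds zero    w = []
odds (suc n) w = first-bit (List.drop 1 w) ∷ odds n (List.drop 2 w)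

choice : Bool → Bool → Bool → Bool
choice c x x′ = if c then x′ else x

cells : ∀ {n} → Vec Bool n → Vec Bool n → Stack
cells ρ σ = toList (zipWith pair ρ σ)

mark : Bool → Bool → Stack → Stack
mark x x′ = push (if x xor x′ then just (bit I) else nothing)

marks : ∀ {n} → Vec Bool n → Vec Bool n → Stack → Stack
marks []      []        D = D
marks (x ∷ u) (x′ ∷ u′) D = marks u u′ (mark x x′ D)

cells-length : ∀ {n} (ρ σ : Vec Bool n) → length (cells ρ σ) ≡ n
cells-length ρ σ = length-toList (zipWith pair ρ σ)

cells-++ : ∀ {m n} (ρ σ : Vec Bool m) (ρ′ σ′ : Vec Bool n) →
           cells (ρ ++ ρ′) (σ ++ σ′) ≡ cells ρ σ ⁀ cells ρ′ σ′
cells-++ []      []      ρ′ σ′ = refl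
cells-++ (a ∷ ρ) (b ∷ σ) ρ′ σ′ = cong (_ ∷_) (cells-++ ρ σ ρ′ σ′)

cells-diagonal : ∀ {n} (y : Vec Bool n) → cells y y ≡ List.map (λ b → pair b b) (toList y)
cells-diagonal []      = refl
cells-diagonal (b ∷ y) = cong (_ ∷_) (cells-diagonal y)

cells-reverse : ∀ {n} (y : Vec Bool n) →
                cells (Vec.reverse y) (Vec.reverse y) ≡ cells y y ʳ++ []
cells-reverse y = begin
  cells (Vec.reverse y) (Vec.reverse y)    ≡⟨ cells-diagonal (Vec.reverse y) ⟩
  List.map d (toList (Vec.reverse y))      ≡⟨ cong (List.map d) (toList-reverse y) ⟩
  List.map d (List.reverse (toList y))     ≡⟨ reverse-map d (toList y) ⟩
  List.reverse (List.map d (toList y))     ≡⟨ cong List.reverse (sym (cells-diagonal y)) ⟩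
  cells y y ʳ++ []                         ∎
  where
  open ≡-Reasoning
  d : Bool → Letter
  d b = pair b b

module Setup (circuits : Bool) (verdict : Bool → Bool → Bool) where
  open Program circuits verdict

  -- Runs are composed backwards, from a run of the later configuration. The case split only lets
  -- the pops compute: an exhausted certificate reads as O, in agreement with `first-bit`, so
  -- certificates of every length are covered.
  count-one : ∀ {t c w b} u v {M B E K D} →
    Runs t (running (count c))
      (bits w ∷ bits (List.drop 2 u) ∷ bits (List.drop 2 v) ∷
       (pair (first-bit v) (first-bit v) ∷ M) ∷
       (pair (choice c (first-bit u) (first-bit (List.drop 1 u))) (first-bit (List.drop 1 v)) ∷ B) ∷
       E ∷ (bit I ∷ K) ∷ mark (first-bit u) (first-bit (List.drop 1 u)) D ∷ []) b →
    Runs (3 + t) (running (count c))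
      (bits (I ∷ w) ∷ bits u ∷ bits v ∷ M ∷ B ∷ E ∷ K ∷ D ∷ []) b
  count-one []          []          k = tick (tick (tick k))
  count-one []          (_ ∷ [])    k = tick (tick (tick k))
  count-one []          (_ ∷ _ ∷ _) k = tick (tick (tick k))
  count-one (_ ∷ [])    []          k = tick (tick (tick k))
  count-one (_ ∷ [])    (_ ∷ [])    k = tick (tick (tick k))
  count-one (_ ∷ [])    (_ ∷ _ ∷ _) k = tick (tick (tick k))
  count-one (_ ∷ _ ∷ _) []          k = tick (tick (tick k))
  count-one (_ ∷ _ ∷ _) (_ ∷ [])    k = tick (tick (tick k))
  count-one (_ ∷ _ ∷ _) (_ ∷ _ ∷ _) k = tick (tick (tick k))

  -- The certificates are not read after the header, so the continuation takes their remainders as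
  -- arbitrary; of the counter it keeps only the length.
  count-all : ∀ n {t c w b} u v {M B E K D} →
    (∀ {U V K′} → length K′ ≡ n + length K →
     Runs t (running (count c))
       (bits w ∷ U ∷ V ∷ (cells (evens n v) (evens n v) ʳ++ M) ∷
        (cells (zipWith (choice c) (evens n u) (odds n u)) (odds n v) ʳ++ B) ∷
        E ∷ K′ ∷ marks (evens n u) (odds n u) D ∷ []) b) →
    Runs (n * 3 + t) (running (count c))
      (bits (replicate n I ⁀ w) ∷ bits u ∷ bits v ∷ M ∷ B ∷ E ∷ K ∷ D ∷ []) b
  count-all zero    u v k = k refl
  count-all (suc n) u v {K = K} k =
    count-one u v (count-all n _ _ λ l → k (trans l (+-suc n (length K))))

  restore-all : ∀ {t q b W U V M} B {E K D} →
    Runs t (running q) (W ∷ U ∷ V ∷ (B ʳ++ M) ∷ [] ∷ E ∷ K ∷ D ∷ []) b →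
    Runs (suc (length B) + t) (restore q) (W ∷ U ∷ V ∷ M ∷ B ∷ E ∷ K ∷ D ∷ []) b
  restore-all []      k = tick k
  restore-all (l ∷ B) k = tick (restore-all B k)

  choose-branch : ∀ {t b} w u v →
    Runs t (running (count (first-bit v)))
      (bits w ∷ bits u ∷ bits (List.drop 1 v) ∷ [] ∷ [] ∷ [] ∷ [] ∷ [] ∷ []) b →
    Runs (suc t) (running choose) (inputs machine (w ∷ u ∷ v ∷ [])) b
  choose-branch w u []      k = tick k
  choose-branch w u (_ ∷ _) k = tick k

  -- One step reads c, three handle each letter of the header, one its end, and n + 1 move the
  -- buffer back.
  setup : ∀ n {t w b} u v →
    let x  = evens n u ; x′ = odds n u
        y  = Vec.reverse (evens n (List.drop 1 v)) ; z = odds n (List.drop 1 v)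
    in
    (∀ {U V K} → length K ≡ n →
     Runs t (running decode)
       (bits w ∷ U ∷ V ∷ cells (zipWith (choice (first-bit v)) x x′ ++ y) (z ++ y) ∷
        [] ∷ [] ∷ K ∷ marks x x′ [] ∷ []) b) →
    Runs (1 + (n * 3 + (1 + (suc n + t)))) (running choose)
      (inputs machine ((unary n ⁀ w) ∷ u ∷ v ∷ [])) b
  setup n {t} {w} {b} u v k = choose-branch (unary n ⁀ w) u v
    (subst (λ W → Runs (n * 3 + (1 + (suc n + t))) (running (count (first-bit v)))
                    (bits W ∷ bits u ∷ bits (List.drop 1 v) ∷ [] ∷ [] ∷ [] ∷ [] ∷ [] ∷ []) b)
      (sym (++-assoc (replicate n I) (O ∷ []) w))
      (count-all n u (List.drop 1 v) λ {U} {V} {K} l → tick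
        (subst (λ m → Runs (suc m + t) (restore decode)
                        (bits w ∷ U ∷ V ∷ (cells y y ʳ++ []) ∷ (cells s z ʳ++ []) ∷ [] ∷ K ∷ D ∷ []) b)
          lengths
          (restore-all (cells s z ʳ++ [])
            (subst (λ M → Runs t (running decode) (bits w ∷ U ∷ V ∷ M ∷ [] ∷ [] ∷ K ∷ D ∷ []) b)
              (sym memory) (k (trans l (+-identityʳ n))))))))
    where
    y = evens n (List.drop 1 v)
    z = odds n (List.drop 1 v)
    s = zipWith (choice (first-bit v)) (evens n u) (odds n u)
    D = marks (evens n u) (odds n u) []

    lengths : length (cells s z ʳ++ []) ≡ n
    lengths = trans (length-reverse (cells s z)) (cells-length s z)

    memory : (cells s z ʳ++ []) ʳ++ (cells y y ʳ++ []) ≡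
             cells (s ++ Vec.reverse y) (z ++ Vec.reverse y)
    memory = trans (ʳ++-ʳ++ (cells s z))
      (sym (trans (cells-++ s z _ _) (cong (cells s z ⁀_) (cells-reverse y))))

  bare-rejects : ∀ n u v →
    Runs (1 + (n * 3 + 1)) (running choose) (inputs machine (replicate n I ∷ u ∷ v ∷ [])) O
  bare-rejects n u v = choose-branch (replicate n I) u v
    (subst (λ W → Runs (n * 3 + 1) (running (count (first-bit v)))
                    (bits W ∷ bits u ∷ bits (List.drop 1 v) ∷ [] ∷ [] ∷ [] ∷ [] ∷ [] ∷ []) O)
      (++-identityʳ (replicate n I))
      (count-all n u (List.drop 1 v) λ _ → tick (stop refl)))

-- The running time of the parsers.  A letter of an index costs two steps, one
-- for reading it and one for restoring mem afterwards; the remaining steps per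
-- letter pay for processing the token.
time : Word → ℕ
time w = length w * 5 + 6

module Fetching (circuits : Bool) (verdict : Bool → Bool → Bool) where
  open Program circuits verdict
  open Setup circuits verdict

  -- `length B` pays for moving the buffer back. Of the five steps granted for the letter O, one
  -- reads it, one ends the restoring, and three remain for the token that the index completes.
  fetch-O : ∀ {q} w B {m} a b (ρ σ : Vec Bool m) {U V E K D r} →
    Runs (3 + time w) (running q)
      (bits w ∷ U ∷ V ∷ (B ʳ++ cells (a ∷ ρ) (b ∷ σ)) ∷ [] ∷ (pair a b ∷ E) ∷ K ∷ D ∷ []) r →
    Runs (time (O ∷ w) + length B) (fetch q)
      (bits (O ∷ w) ∷ U ∷ V ∷ cells (a ∷ ρ) (b ∷ σ) ∷ B ∷ E ∷ K ∷ D ∷ []) r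
  fetch-O {q} w B a b ρ σ {U} {V} {E} {K} {D} {r} k = tick
    (subst (λ n → Runs n (restore q) (bits w ∷ U ∷ V ∷ cells (a ∷ ρ) (b ∷ σ) ∷ B ∷ (pair a b ∷ E) ∷ K ∷ D ∷ []) r)
      rearrange (restore-all B k))
    where
    rearrange : suc (length B) + (3 + time w) ≡ 4 + (time w + length B)
    rearrange = trans (+-comm (suc (length B)) (3 + time w)) (cong (3 +_) (+-suc (time w) (length B)))

  -- Of five steps, one reads the letter, one is saved for returning the shifted cell, and three are
  -- discarded.
  fetch-I : ∀ {q} w B {m} a b (ρ σ : Vec Bool m) {U V E K D r} →
    Runs (time w + length (pair a b ∷ B)) (fetch q)
      (bits w ∷ U ∷ V ∷ cells ρ σ ∷ (pair a b ∷ B) ∷ E ∷ K ∷ D ∷ []) r →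
    Runs (time (I ∷ w) + length B) (fetch q)
      (bits (I ∷ w) ∷ U ∷ V ∷ cells (a ∷ ρ) (b ∷ σ) ∷ B ∷ E ∷ K ∷ D ∷ []) r
  fetch-I {q} w B a b ρ σ {U} {V} {E} {K} {D} {r} k = tick (later machine 3
    (subst (λ n → Runs n (fetch q) (bits w ∷ U ∷ V ∷ cells ρ σ ∷ (pair a b ∷ B) ∷ E ∷ K ∷ D ∷ []) r)
      (+-suc (time w) (length B)) k))

unary-snoc : ∀ p w → replicate p I ⁀ (I ∷ w) ≡ replicate (suc p) I ⁀ w
unary-snoc zero    w = refl
unary-snoc (suc p) w = cong (I ∷_) (unary-snoc p w)

unary-⁀ : ∀ p w → unary p ⁀ w ≡ replicate p I ⁀ (O ∷ w)
unary-⁀ p w = ++-assoc (replicate p I) (O ∷ []) w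

-- Parsing and evaluating formulas.

binary : ∀ {n} → Bool → Formula n → Formula n → Formula n
binary O = and
binary I = or

encode-binary : ∀ {n} o (φ ψ : Formula n) →
                encodeF (binary o φ ψ) ≡ encodeF φ ⁀ encodeF ψ ⁀ (I ∷ O ∷ o ∷ [])
encode-binary O φ ψ = refl
encode-binary I φ ψ = refl

eval-binary : ∀ {n} o (φ ψ : Formula n) ρ →
              evalF (binary o φ ψ) ρ ≡ connective o (evalF φ ρ) (evalF ψ ρ)
eval-binary O φ ψ ρ = refl
eval-binary I φ ψ ρ = refl

-- The stack of a formula parser holds the completed subformulas.  Having read
-- part of an index, it remembers by ι what the indices within the unread rest
-- of the memory stand for.
module _ {n : ℕ} where
  mutual
    formula : Word → List (Formula n) → Maybe (Formula n)
    formula []              (φ ∷ [])     = just φ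
    formula (O ∷ O ∷ b ∷ w) φs           = formula w (const b ∷ φs)
    formula (O ∷ I ∷ w)     (φ ∷ φs)     = formula w (neg φ ∷ φs)
    formula (I ∷ O ∷ o ∷ w) (ψ ∷ φ ∷ φs) = formula w (binary o φ ψ ∷ φs)
    formula (I ∷ I ∷ w)     φs           = variable′ n id w φs
    formula _               _            = nothing

    variable′ : ∀ m → (Fin m → Fin n) → Word → List (Formula n) → Maybe (Formula n)
    variable′ (suc m) ι (I ∷ w) φs = variable′ m (ι ∘ suc) w φs
    variable′ (suc m) ι (O ∷ w) φs = formula w (var (ι zero) ∷ φs)
    variable′ _       _ _       _  = nothing

  variable-unary : ∀ {m} (ι : Fin m → Fin n) i w φs →
    variable′ m ι (unary (toℕ i) ⁀ w) φs ≡ formula w (var (ι i) ∷ φs)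
  variable-unary ι zero    w φs = refl
  variable-unary ι (suc i) w φs = variable-unary (ι ∘ suc) i w φs

  formula-encode : ∀ φ w φs → formula (encodeF φ ⁀ w) φs ≡ formula w (φ ∷ φs)
  formula-encode (var i)   w φs = variable-unary id i w φs
  formula-encode (const b) w φs = refl
  formula-encode (neg φ)   w φs
    rewrite ++-assoc (encodeF φ) (O ∷ I ∷ []) w = formula-encode φ (O ∷ I ∷ w) φs
  formula-encode (and φ ψ) w φs
    rewrite ++-assoc (encodeF φ) (encodeF ψ ⁀ (I ∷ O ∷ O ∷ [])) w
          | ++-assoc (encodeF ψ) (I ∷ O ∷ O ∷ []) w
    = trans (formula-encode φ _ φs) (formula-encode ψ _ (φ ∷ φs))
  formula-encode (or φ ψ)  w φs
    rewrite ++-assoc (encodeF φ) (encodeF ψ ⁀ (I ∷ O ∷ I ∷ [])) w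
          | ++-assoc (encodeF ψ) (I ∷ O ∷ I ∷ []) w
    = trans (formula-encode φ _ φs) (formula-encode ψ _ (φ ∷ φs))

  encodes : List (Formula n) → Word
  encodes []       = []
  encodes (φ ∷ φs) = encodes φs ⁀ encodeF φ

  mutual
    -- The codes of the stacked subformulas, deepest first, followed by the unread word always spell
    -- the input; a parser step only rebrackets this concatenation.
    formula-sound : ∀ w φs {φ} → formula w φs ≡ just φ → encodes φs ⁀ w ≡ encodeF φ
    formula-sound []              (φ ∷ [])     refl = ++-identityʳ (encodeF φ)
    formula-sound (O ∷ O ∷ b ∷ w) φs           e =
      trans (sym (++-assoc (encodes φs) (O ∷ O ∷ b ∷ []) w)) (formula-sound w (const b ∷ φs) e)
    formula-sound (O ∷ I ∷ w)     (φ ∷ φs)     e =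
      trans (solve (encodes φs) (encodeF φ) (O ∷ I ∷ []) w) (formula-sound w (neg φ ∷ φs) e)
      where
      solve : ∀ (a b c d : Word) → (a ⁀ b) ⁀ (c ⁀ d) ≡ (a ⁀ (b ⁀ c)) ⁀ d
      solve a b c d = trans (sym (++-assoc (a ⁀ b) c d)) (cong (_⁀ d) (++-assoc a b c))
    formula-sound (I ∷ O ∷ o ∷ w) (ψ ∷ φ ∷ φs) e =
      trans (solve (encodes φs) (encodeF φ) (encodeF ψ) (I ∷ O ∷ o ∷ []) w)
        (trans (cong (λ c → (encodes φs ⁀ c) ⁀ w) (sym (encode-binary o φ ψ)))
          (formula-sound w (binary o φ ψ ∷ φs) e))
      where
      solve : ∀ (a b c d e : Word) → ((a ⁀ b) ⁀ c) ⁀ (d ⁀ e) ≡ (a ⁀ (b ⁀ (c ⁀ d))) ⁀ e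
      solve a b c d e = trans (sym (++-assoc ((a ⁀ b) ⁀ c) d e))
        (cong (_⁀ e) (trans (++-assoc (a ⁀ b) c d) (++-assoc a b (c ⁀ d))))
    formula-sound (I ∷ I ∷ w)     φs           e = variable-sound 0 n id w φs (λ _ → refl) e

    -- `p` counts the letters I of the index read so far, which is the shift performed by `ι`.
    variable-sound : ∀ p m (ι : Fin m → Fin n) w φs {φ} → (∀ j → toℕ (ι j) ≡ p + toℕ j) →
      variable′ m ι w φs ≡ just φ → encodes φs ⁀ (I ∷ I ∷ replicate p I ⁀ w) ≡ encodeF φ
    variable-sound p (suc m) ι (I ∷ w) φs h e =
      trans (cong (λ c → encodes φs ⁀ (I ∷ I ∷ c)) (unary-snoc p w))
        (variable-sound (suc p) m (ι ∘ suc) w φs (λ j → trans (h (suc j)) (+-suc p (toℕ j))) e)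
    variable-sound p (suc m) ι (O ∷ w) φs h e =
      trans (cong (λ c → encodes φs ⁀ (I ∷ I ∷ c))
              (trans (sym (unary-⁀ p w))
                (cong (λ k → unary k ⁀ w) (sym (trans (h zero) (+-identityʳ p))))))
        (trans (sym (++-assoc (encodes φs) (I ∷ I ∷ unary (toℕ (ι zero))) w))
          (formula-sound w (var (ι zero) ∷ φs) e))

module FormulaRun (verdict : Bool → Bool → Bool) {n} (ρ σ : Vec Bool n) (U V K D : Stack) where
  open Program O verdict
  open Fetching O verdict

  outcome : Maybe (Formula n) → Bool
  outcome = maybe′ (λ φ → verdict (is-nothing (List.head D)) (evalF φ ρ)) O

  values : List (Formula n) → Stack
  values = List.map (λ φ → pair (evalF φ ρ) (evalF φ σ))

  stacks : Word → Stack → Stack → Stack → Vec Stack 8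
  stacks w M B E = bits w ∷ U ∷ V ∷ M ∷ B ∷ E ∷ K ∷ D ∷ []

  mutual
    -- Induction along the clauses of the parser: the ticks are the machine steps spent on a token,
    -- and `later` discards what is left of its five steps per letter.
    formula-run : ∀ w φs →
      Runs (time w) (running decode) (stacks w (cells ρ σ) [] (values φs))
        (outcome (formula w φs))
    formula-run []              []           = tick (tick (stop refl))
    formula-run []              (φ ∷ [])     = tick (tick (tick (tick (stop refl))))
    formula-run []              (_ ∷ _ ∷ _)  = tick (tick (tick (stop refl)))
    formula-run (O ∷ [])        φs           = tick (tick (stop refl))
    formula-run (O ∷ O ∷ [])    φs           = tick (tick (tick (stop refl)))
    formula-run (O ∷ O ∷ b ∷ w) φs           = tick (tick (tick (later machine 12 (formula-run w (const b ∷ φs)))))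
    formula-run (O ∷ I ∷ w)     []           = tick (tick (tick (stop refl)))
    formula-run (O ∷ I ∷ w)     (φ ∷ φs)     = tick (tick (tick (later machine 7 (formula-run w (neg φ ∷ φs)))))
    formula-run (I ∷ [])        φs           = tick (tick (stop refl))
    formula-run (I ∷ O ∷ [])    φs           = tick (tick (tick (stop refl)))
    formula-run (I ∷ O ∷ o ∷ w) []           = tick (tick (tick (tick (stop refl))))
    formula-run (I ∷ O ∷ o ∷ w) (_ ∷ [])     = tick (tick (tick (tick (tick (stop refl)))))
    formula-run (I ∷ O ∷ o ∷ w) (ψ ∷ φ ∷ φs) = tick (tick (tick (tick (tick (later machine 10
      (subst (λ E → Runs (time w) (running decode) (stacks w (cells ρ σ) [] E)
                      (outcome (formula w (binary o φ ψ ∷ φs))))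
        (cong₂ (λ a b → pair a b ∷ values φs) (eval-binary o φ ψ ρ) (eval-binary o φ ψ σ))
        (formula-run w (binary o φ ψ ∷ φs))))))))
    formula-run (I ∷ I ∷ w)     φs           = tick (tick (later machine 8
      (subst (λ t → Runs t (fetch decode) (stacks w (cells ρ σ) [] (values φs))
                      (outcome (variable′ n id w φs)))
        (+-identityʳ (time w))
        (variable-run n id w φs ρ σ [] refl (λ _ → refl) (λ _ → refl)))))

    -- Buffer and memory together remain the original memory, so the lookup is undone by restoring,
    -- and the cell on top is the one that `ι zero` names.
    variable-run : ∀ m ι w φs (ρ′ σ′ : Vec Bool m) B → B ʳ++ cells ρ′ σ′ ≡ cells ρ σ →
      (∀ j → lookup ρ′ j ≡ lookup ρ (ι j)) → (∀ j → lookup σ′ j ≡ lookup σ (ι j)) →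
      Runs (time w + length B) (fetch decode) (stacks w (cells ρ′ σ′) B (values φs))
        (outcome (variable′ m ι w φs))
    variable-run zero    ι []      φs []       []       B e h k = tick (stop refl)
    variable-run zero    ι (_ ∷ _) φs []       []       B e h k = tick (stop refl)
    variable-run (suc m) ι []      φs (a ∷ ρ′) (b ∷ σ′) B e h k = tick (stop refl)
    variable-run (suc m) ι (I ∷ w) φs (a ∷ ρ′) (b ∷ σ′) B e h k =
      fetch-I w B a b ρ′ σ′
        (variable-run m (ι ∘ suc) w φs ρ′ σ′ (pair a b ∷ B) e (h ∘ suc) (k ∘ suc))
    variable-run (suc m) ι (O ∷ w) φs (a ∷ ρ′) (b ∷ σ′) B e h k =
      fetch-O w B a b ρ′ σ′ (later machine 3
        (subst₂ (λ M l → Runs (time w) (running decode) (stacks w M [] (l ∷ values φs))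
                           (outcome (formula w (var (ι zero) ∷ φs))))
          (sym e) (sym (cong₂ pair (h zero) (k zero)))
          (formula-run w (var (ι zero) ∷ φs))))

-- Parsing and evaluating circuits.

gate₂ : ∀ {v} → Bool → Fin v → Fin v → Gate v
gate₂ O = and
gate₂ I = or

encode-gate₂ : ∀ {v} o (i j : Fin v) →
  encodeG (gate₂ o i j) ≡ I ∷ O ∷ o ∷ unary (toℕ i) ⁀ unary (toℕ j)
encode-gate₂ O i j = refl
encode-gate₂ I i j = refl

eval-gate₂ : ∀ {v} o (i j : Fin v) ρ →
  evalG (gate₂ o i j) ρ ≡ connective o (lookup ρ i) (lookup ρ j)
eval-gate₂ O i j ρ = refl
eval-gate₂ I i j ρ = refl

data Phase : Set where
  gates   : Phase
  outputs : ℕ → Phase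

-- A hole is the part of a gate or of the output list that precedes the index
-- being read.
data Hole (v : ℕ) : Phase → Set where
  argument  : Hole v gates
  argument₁ : Bool → Hole v gates
  argument₂ : Bool → Fin v → Hole v gates
  output   : ∀ {o} → Hole v (outputs (suc o))

module _ {n : ℕ} where
  Parsed : Phase → ℕ → Set
  Parsed gates       v = ∃[ k ] Gates v k × Vec (Fin k) n
  Parsed (outputs o) v = Vec (Fin v) o

  prepend : ∀ {v} → Gate v → Parsed gates (suc v) → Parsed gates v
  prepend g (k , gs , os) = k , g ∷ gs , os

  mutual
    parse : ∀ ph v → Word → Maybe (Parsed ph v)
    parse gates             v (O ∷ O ∷ b ∷ w) = Maybe.map (prepend (const b)) (parse gates (suc v) w)
    parse gates             v (O ∷ I ∷ w)     = index argument v id w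
    parse gates             v (I ∷ O ∷ o ∷ w) = index (argument₁ o) v id w
    parse gates             v (I ∷ I ∷ w)     = Maybe.map (λ os → v , [] , os) (parse (outputs n) v w)
    parse gates             v _               = nothing
    parse (outputs zero)    v []              = just []
    parse (outputs zero)    v (_ ∷ _)         = nothing
    parse (outputs (suc o)) v w               = index output v id w

    index : ∀ {ph v} → Hole v ph → ∀ m → (Fin m → Fin v) → Word → Maybe (Parsed ph v)
    index h (suc m) ι (I ∷ w) = index h m (ι ∘ suc) w
    index h (suc m) ι (O ∷ w) = resume h (ι zero) w
    index h _       _ _       = nothing

    resume : ∀ {ph v} → Hole v ph → Fin v → Word → Maybe (Parsed ph v)
    resume argument        i w = Maybe.map (prepend (neg i)) (parse gates _ w)
    resume (argument₁ o)   i w = index (argument₂ o i) _ id w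
    resume (argument₂ o i) j w = Maybe.map (prepend (gate₂ o i j)) (parse gates _ w)
    resume output         i w = Maybe.map (i ∷_) (parse (outputs _) _ w)

  index-unary : ∀ {ph v m} (h : Hole v ph) (ι : Fin m → Fin v) i w →
    index h m ι (unary (toℕ i) ⁀ w) ≡ resume h (ι i) w
  index-unary h ι zero    w = refl
  index-unary h ι (suc i) w = index-unary h (ι ∘ suc) i w

  encodeP : ∀ ph {v} → Parsed ph v → Word
  encodeP gates       (_ , gs , os) = encodeGs gs ⁀ encodeOs os
  encodeP (outputs o) os            = encodeOs os

  parse-outputs : ∀ {v o} (os : Vec (Fin v) o) → parse (outputs o) v (encodeOs os) ≡ just os
  parse-outputs []       = refl
  parse-outputs (i ∷ os) = trans (index-unary output id i (encodeOs os))
    (cong (Maybe.map (i ∷_)) (parse-outputs os))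

  parse-binary : ∀ {v} o (i j : Fin v) w →
    parse gates v (encodeG (gate₂ o i j) ⁀ w) ≡
    Maybe.map (prepend (gate₂ o i j)) (parse gates (suc v) w)
  parse-binary o i j w
    rewrite encode-gate₂ o i j | ++-assoc (unary (toℕ i)) (unary (toℕ j)) w
    = trans (index-unary (argument₁ o) id i _) (index-unary (argument₂ o i) id j w)

  parse-gate : ∀ {v} (g : Gate v) w →
    parse gates v (encodeG g ⁀ w) ≡ Maybe.map (prepend g) (parse gates (suc v) w)
  parse-gate (const b) w = refl
  parse-gate (neg i)   w = index-unary argument id i w
  parse-gate (and i j) w = parse-binary O i j w
  parse-gate (or i j)  w = parse-binary I i j w

  parse-gates : ∀ {v k} (gs : Gates v k) (os : Vec (Fin k) n) →
    parse gates v (encodeGs gs ⁀ encodeOs os) ≡ just (k , gs , os)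
  parse-gates []       os rewrite parse-outputs os = refl
  parse-gates (g ∷ gs) os
    rewrite ++-assoc (encodeG g) (encodeGs gs) (encodeOs os)
          | parse-gate g (encodeGs gs ⁀ encodeOs os)
          | parse-gates gs os = refl

  prefix : ∀ {ph v} → Hole v ph → Word
  prefix argument        = O ∷ I ∷ []
  prefix (argument₁ o)   = I ∷ O ∷ o ∷ []
  prefix (argument₂ o i) = I ∷ O ∷ o ∷ unary (toℕ i)
  prefix output         = []

  mutual
    parse-sound : ∀ ph v w {x} → parse ph v w ≡ just x → w ≡ encodeP ph x
    parse-sound gates v (O ∷ O ∷ b ∷ w) e with just x ← parse gates (suc v) w in eq | refl ← e
      = cong (λ w → O ∷ O ∷ b ∷ w) (parse-sound gates (suc v) w eq)
    parse-sound gates v (O ∷ I ∷ w)     e = index-sound argument 0 v id w (λ _ → refl) e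
    parse-sound gates v (I ∷ O ∷ o ∷ w) e = index-sound (argument₁ o) 0 v id w (λ _ → refl) e
    parse-sound gates v (I ∷ I ∷ w)     e with just os ← parse (outputs n) v w in eq | refl ← e
      = cong (λ w → I ∷ I ∷ w) (parse-sound (outputs n) v w eq)
    parse-sound (outputs zero)    v []  refl = refl
    parse-sound (outputs (suc o)) v w   e    = index-sound output 0 v id w (λ _ → refl) e

    index-sound : ∀ {ph v} (h : Hole v ph) p m (ι : Fin m → Fin v) w {x} →
      (∀ j → toℕ (ι j) ≡ p + toℕ j) → index h m ι w ≡ just x →
      prefix h ⁀ (replicate p I ⁀ w) ≡ encodeP ph x
    index-sound h p (suc m) ι (I ∷ w) l e =
      trans (cong (prefix h ⁀_) (unary-snoc p w))
        (index-sound h (suc p) m (ι ∘ suc) w (λ j → trans (l (suc j)) (+-suc p (toℕ j))) e)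
    index-sound h p (suc m) ι (O ∷ w) l e =
      trans (cong (prefix h ⁀_)
              (trans (sym (unary-⁀ p w))
                (cong (λ k → unary k ⁀ w) (sym (trans (l zero) (+-identityʳ p))))))
        (resume-sound h (ι zero) w e)

    resume-sound : ∀ {ph v} (h : Hole v ph) i w {x} → resume h i w ≡ just x →
      prefix h ⁀ (unary (toℕ i) ⁀ w) ≡ encodeP ph x
    resume-sound {v = v} argument i w e with just (_ , gs , os) ← parse gates (suc v) w in eq | refl ← e
      = cong (λ w → O ∷ I ∷ w)
          (trans (cong (unary (toℕ i) ⁀_) (parse-sound gates _ w eq))
            (sym (++-assoc (unary (toℕ i)) (encodeGs gs) (encodeOs os))))
    resume-sound (argument₁ o) i w e =
      index-sound (argument₂ o i) 0 _ id w (λ _ → refl) e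
    resume-sound {v = v} (argument₂ o i) j w e with just (_ , gs , os) ← parse gates (suc v) w in eq | refl ← e
      = trans (cong (λ w → (I ∷ O ∷ o ∷ unary (toℕ i)) ⁀ (unary (toℕ j) ⁀ w)) (parse-sound gates _ w eq))
          (trans (sym (++-assoc (I ∷ O ∷ o ∷ unary (toℕ i)) (unary (toℕ j)) (encodeGs gs ⁀ encodeOs os)))
            (trans (cong (_⁀ (encodeGs gs ⁀ encodeOs os)) (sym (encode-gate₂ o i j)))
              (sym (++-assoc (encodeG (gate₂ o i j)) (encodeGs gs) (encodeOs os)))))
    resume-sound {v = v} (output {o}) i w e with just os ← parse (outputs o) v w in eq | refl ← e
      = cong (unary (toℕ i) ⁀_) (parse-sound (outputs _) _ w eq)

-- Compares two numbers from the most significant bit on.  The answer r is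
-- final once d holds; up to then the numbers agree and r is true.
dominates : ∀ {n} → Bool → Bool → Vec Bool n → Vec Bool n → Bool
dominates d r []      []      = r
dominates d r (a ∷ x) (b ∷ y) =
  dominates (d ∨ (a xor b)) (if d ∨ not (a xor b) then r else a) x y

module CircuitRun (verdict : Bool → Bool → Bool) (n : ℕ) (U V D : Stack) where
  open Program I verdict
  open Fetching I verdict

  stacks : Word → Stack → Stack → Stack → Stack → Vec Stack 8
  stacks w M B E K = bits w ∷ U ∷ V ∷ M ∷ B ∷ E ∷ K ∷ D ∷ []

  answer : Bool → Bool
  answer = verdict (is-nothing (List.head D))

  compare-outputs : ∀ {v o} → Bool → Bool → Vec Bool v → Vec Bool v → Vec (Fin v) o → Bool
  compare-outputs d r ρ σ os = answer (dominates d r (Vec.map (lookup ρ) os) (Vec.map (lookup σ) os))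

  outcome : ∀ ph {v} → Bool → Bool → Vec Bool v → Vec Bool v → Maybe (Parsed {n} ph v) → Bool
  outcome gates       d r ρ σ =
    maybe′ (λ (_ , gs , os) → compare-outputs O I (evalGs gs ρ) (evalGs gs σ) os) O
  outcome (outputs o) d r ρ σ = maybe′ (compare-outputs d r ρ σ) O

  outcome-prepend : ∀ {v} d r (g : Gate v) ρ σ m →
    outcome gates O I (evalG g ρ ∷ ρ) (evalG g σ ∷ σ) m ≡
    outcome gates d r ρ σ (Maybe.map (prepend g) m)
  outcome-prepend d r g ρ σ nothing  = refl
  outcome-prepend d r g ρ σ (just _) = refl

  outcome-outputs : ∀ {v} d r (ρ σ : Vec Bool v) m →
    outcome (outputs n) O I ρ σ m ≡ outcome gates d r ρ σ (Maybe.map (λ os → v , [] , os) m)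
  outcome-outputs d r ρ σ nothing  = refl
  outcome-outputs d r ρ σ (just _) = refl

  -- `outcome ph` is stuck until the phase is known, although a failed parse yields O in both
  -- phases.
  no-index : ∀ ph {v} d r (ρ σ : Vec Bool v) {t q ss} →
             Runs t q ss O → Runs t q ss (outcome ph d r ρ σ nothing)
  no-index gates       d r ρ σ k = k
  no-index (outputs o) d r ρ σ k = k

  operands : ∀ {ph v} → Hole v ph → Vec Bool v → Vec Bool v → Stack
  operands (argument₂ o i) ρ σ = pair (lookup ρ i) (lookup σ i) ∷ []
  operands _               ρ σ = []

  -- `emit` has already popped the letter of the output being read; during the gates the counter is
  -- still complete.
  remaining : ∀ {ph v} → Hole v ph → ℕ
  remaining (output {o}) = o
  remaining _            = n

  target : ∀ {ph v} → Bool → Bool → Hole v ph → Control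
  target d r argument        = negate
  target d r (argument₁ o)   = operand o
  target d r (argument₂ o i) = binary₁ o
  target d r output         = compare d r

  mutual
    gates-run : ∀ {v} w (ρ σ : Vec Bool v) d r K → length K ≡ n →
      Runs (time w) (running decode) (stacks w (cells ρ σ) [] [] K)
        (outcome gates d r ρ σ (parse gates v w))
    gates-run []              ρ σ d r K l = tick (stop refl)
    gates-run (O ∷ [])        ρ σ d r K l = tick (tick (stop refl))
    gates-run (O ∷ O ∷ [])    ρ σ d r K l = tick (tick (tick (stop refl)))
    gates-run (O ∷ O ∷ b ∷ w) ρ σ d r K l = tick (tick (tick (tick (later machine 11
      (subst (Runs _ _ _) (outcome-prepend d r (const b) ρ σ (parse gates _ w))
        (gates-run w (b ∷ ρ) (b ∷ σ) O I K l))))))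
    gates-run (O ∷ I ∷ w)     ρ σ d r K l = tick (tick (later machine 8 (arguments-run argument w ρ σ d r K l)))
    gates-run (I ∷ [])        ρ σ d r K l = tick (tick (stop refl))
    gates-run (I ∷ O ∷ [])    ρ σ d r K l = tick (tick (tick (stop refl)))
    gates-run (I ∷ O ∷ o ∷ w) ρ σ d r K l =
      tick (tick (tick (later machine 12 (arguments-run (argument₁ o) w ρ σ d r K l))))
    gates-run (I ∷ I ∷ w)     ρ σ d r K l = tick (tick (later machine 7
      (subst (Runs _ _ _) (outcome-outputs d r ρ σ (parse (outputs n) _ w))
        (outputs-run n w ρ σ O I K l))))

    outputs-run : ∀ {v} o w (ρ σ : Vec Bool v) d r K → length K ≡ o →
      Runs (1 + time w) (running (emit d r)) (stacks w (cells ρ σ) [] [] K)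
        (outcome (outputs o) d r ρ σ (parse (outputs o) v w))
    outputs-run zero    []      ρ σ d r []      l = tick (tick (tick (stop refl)))
    outputs-run zero    (_ ∷ w) ρ σ d r []      l = tick (tick (stop refl))
    outputs-run (suc o) w       ρ σ d r (_ ∷ K) l =
      tick (arguments-run output w ρ σ d r K (suc-injective l))

    arguments-run : ∀ {ph v} (h : Hole v ph) w (ρ σ : Vec Bool v) d r K → length K ≡ remaining h →
      Runs (time w) (fetch (target d r h)) (stacks w (cells ρ σ) [] (operands h ρ σ) K)
        (outcome ph d r ρ σ (index h v id w))
    arguments-run {v = v} h w ρ σ d r K l =
      subst (λ t → Runs t (fetch (target d r h)) (stacks w (cells ρ σ) [] (operands h ρ σ) K)
                     (outcome _ d r ρ σ (index h v id w)))
        (+-identityʳ (time w))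
        (index-run h v id w ρ σ ρ σ [] d r K l refl (λ _ → refl) (λ _ → refl))

    index-run : ∀ {ph v} (h : Hole v ph) m (ι : Fin m → Fin v) w (ρ σ : Vec Bool v) (ρ′ σ′ : Vec Bool m)
      B d r K → length K ≡ remaining h → B ʳ++ cells ρ′ σ′ ≡ cells ρ σ →
      (∀ j → lookup ρ′ j ≡ lookup ρ (ι j)) → (∀ j → lookup σ′ j ≡ lookup σ (ι j)) →
      Runs (time w + length B) (fetch (target d r h)) (stacks w (cells ρ′ σ′) B (operands h ρ σ) K)
        (outcome ph d r ρ σ (index h m ι w))
    index-run {ph} h zero    ι []      ρ σ []       []       B d r K l e p q = no-index ph d r ρ σ (tick (stop refl))
    index-run {ph} h zero    ι (_ ∷ _) ρ σ []       []       B d r K l e p q = no-index ph d r ρ σ (tick (stop refl))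
    index-run {ph} h (suc m) ι []      ρ σ (a ∷ ρ′) (b ∷ σ′) B d r K l e p q = no-index ph d r ρ σ (tick (stop refl))
    index-run h (suc m) ι (I ∷ w) ρ σ (a ∷ ρ′) (b ∷ σ′) B d r K l e p q =
      fetch-I w B a b ρ′ σ′
        (index-run h m (ι ∘ suc) w ρ σ ρ′ σ′ (pair a b ∷ B) d r K l e (p ∘ suc) (q ∘ suc))
    index-run h (suc m) ι (O ∷ w) ρ σ (a ∷ ρ′) (b ∷ σ′) B d r K l e p q =
      fetch-O w B a b ρ′ σ′
        (subst₂ (λ M c → Runs (3 + time w) (running (target d r h)) (stacks w M [] (c ∷ operands h ρ σ) K)
                           (outcome _ d r ρ σ (resume h (ι zero) w)))
          (sym e) (sym (cong₂ pair (p zero) (q zero)))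
          (resume-run h (ι zero) w ρ σ d r K l))

    resume-run : ∀ {ph v} (h : Hole v ph) i w (ρ σ : Vec Bool v) d r K → length K ≡ remaining h →
      Runs (3 + time w) (running (target d r h))
        (stacks w (cells ρ σ) [] (pair (lookup ρ i) (lookup σ i) ∷ operands h ρ σ) K)
        (outcome ph d r ρ σ (resume h i w))
    resume-run argument        i w ρ σ d r K l = tick (tick (later machine 1
      (subst (Runs _ _ _) (outcome-prepend d r (neg i) ρ σ (parse gates _ w))
        (gates-run w _ _ O I K l))))
    resume-run (argument₁ o)   i w ρ σ d r K l =
      tick (later machine 2 (arguments-run (argument₂ o i) w ρ σ d r K l))
    -- `binary₁`, `binary₂` and `store` take exactly the three steps that `fetch-O` leaves.
    resume-run (argument₂ o i) j w ρ σ d r K l = tick (tick (tick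
      (subst₂ (λ a b → Runs (time w) (running decode) (stacks w (pair a b ∷ cells ρ σ) [] [] K)
                         (outcome gates d r ρ σ (resume (argument₂ o i) j w)))
        (eval-gate₂ o i j ρ) (eval-gate₂ o i j σ)
        (subst (Runs _ _ _) (outcome-prepend d r (gate₂ o i j) ρ σ (parse gates _ w))
          (gates-run w _ _ O I K l)))))
    resume-run (output {o})    i w ρ σ d r K l = tick (later machine 1
      (subst (Runs _ _ _) (outcome-cons (parse (outputs o) _ w))
        (outputs-run o w ρ σ _ _ K l)))
      where
      outcome-cons : ∀ m → outcome (outputs o) (d ∨ (lookup ρ i xor lookup σ i))
                             (if d ∨ not (lookup ρ i xor lookup σ i) then r else lookup ρ i) ρ σ m ≡
                           outcome (outputs (suc o)) d r ρ σ (Maybe.map (i ∷_) m)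
      outcome-cons nothing  = refl
      outcome-cons (just _) = refl

-- Pairs of vectors inside certificates.

agree : ∀ {n} → Vec Bool n → Vec Bool n → Bool
agree x x′ = is-nothing (List.head (marks x x′ []))

-- `marks` pushes and never pops, so a single difference cannot be forgotten.
marked : ∀ {n} (x x′ : Vec Bool n) l D → is-nothing (List.head (marks x x′ (l ∷ D))) ≡ O
marked []      []       l D = refl
marked (O ∷ x) (O ∷ x′) l D = marked x x′ l D
marked (O ∷ x) (I ∷ x′) l D = marked x x′ (bit I) (l ∷ D)
marked (I ∷ x) (O ∷ x′) l D = marked x x′ (bit I) (l ∷ D)
marked (I ∷ x) (I ∷ x′) l D = marked x x′ l D

agree-≡ : ∀ {n} {x x′ : Vec Bool n} → x ≡ x′ → agree x x′ ≡ I
agree-≡ {x = []}    refl = refl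
agree-≡ {x = O ∷ x} refl = agree-≡ {x = x} refl
agree-≡ {x = I ∷ x} refl = agree-≡ {x = x} refl

agree⇒≡ : ∀ {n} (x x′ : Vec Bool n) → T (agree x x′) → x ≡ x′
agree⇒≡ []      []       h = refl
agree⇒≡ (O ∷ x) (O ∷ x′) h = cong (O ∷_) (agree⇒≡ x x′ h)
agree⇒≡ (O ∷ x) (I ∷ x′) h = ⊥-elim (subst T (marked x x′ (bit I) []) h)
agree⇒≡ (I ∷ x) (O ∷ x′) h = ⊥-elim (subst T (marked x x′ (bit I) []) h)
agree⇒≡ (I ∷ x) (I ∷ x′) h = cong (I ∷_) (agree⇒≡ x x′ h)

choice-diagonal : ∀ {n} c (x : Vec Bool n) → zipWith (choice c) x x ≡ x
choice-diagonal c []      = refl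
choice-diagonal O (a ∷ x) = cong (a ∷_) (choice-diagonal O x)
choice-diagonal I (a ∷ x) = cong (a ∷_) (choice-diagonal I x)

choice-O : ∀ {n} (x x′ : Vec Bool n) → zipWith (choice O) x x′ ≡ x
choice-O []      []       = refl
choice-O (a ∷ x) (_ ∷ x′) = cong (a ∷_) (choice-O x x′)

choice-I : ∀ {n} (x x′ : Vec Bool n) → zipWith (choice I) x x′ ≡ x′
choice-I []      []       = refl
choice-I (_ ∷ x) (a ∷ x′) = cong (a ∷_) (choice-I x x′)

-- The certificate length depends on the whole instance and may exceed 2n; the surplus is padding
-- beyond the reach of `evens` and `odds`.
interleave : ∀ {n m} (x x′ : Vec Bool n) → n * 2 ≤ m →
  Σ (Vec Bool m) λ u → evens n (toList u) ≡ x × odds n (toList u) ≡ x′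
interleave []      []       _             = Vec.replicate _ O , refl , refl
interleave (a ∷ x) (b ∷ x′) (s≤s (s≤s l)) =
  let u , e , o = interleave x x′ l in a ∷ b ∷ u , cong (a ∷_) e , cong (b ∷_) o

-- Unique solvability of a polynomial-time relation lies in `D₂ᴾ`.

record Problem : Set₁ where
  field
    Body     : ℕ → Set
    encode   : ∀ {n} → Body n → Word
    decoded  : ∀ n → Word → Maybe (Body n)
    complete : ∀ {n} (φ : Body n) → decoded n (encode φ) ≡ just φ
    sound    : ∀ {n} w {φ : Body n} → decoded n w ≡ just φ → encode φ ≡ w
    holds    : ∀ {n} → Body n → (x y z : Vec Bool n) → Bool
    circuits : Bool
    runs     : ∀ verdict {n} w (x y z : Vec Bool n) {U V K D} → length K ≡ n →
               Program.Runs circuits verdict (time w) (running decode)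
                 (bits w ∷ U ∷ V ∷ cells (x ++ y) (z ++ y) ∷ [] ∷ [] ∷ K ∷ D ∷ [])
                 (maybe′ (λ φ → verdict (is-nothing (List.head D)) (holds φ x y z)) O (decoded n w))

module _ (P : Problem) where
  open Problem P

  check : (Bool → Bool → Bool) → ∀ {n} → Body n → (x x′ : Vec Bool n) → Bool → (y z : Vec Bool n) → Bool
  check verdict φ x x′ c y z = verdict (agree x x′) (holds φ (zipWith (choice c) x x′) y z)

  checks : (Bool → Bool → Bool) → ∀ {n} → Body n → Word → Word → Bool
  checks verdict {n} φ u v =
    check verdict φ (evens n u) (odds n u) (first-bit v)
      (Vec.reverse (evens n (List.drop 1 v))) (odds n (List.drop 1 v))

  answer : (Bool → Bool → Bool) → ∀ {w} → Header w → Word → Word → Bool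
  answer verdict (bare n)   u v = O
  answer verdict (full n w) u v = maybe′ (λ φ → checks verdict φ u v) O (decoded n w)

  accepts : (Bool → Bool → Bool) → Vec Word 3 → Bool
  accepts verdict (w ∷ u ∷ v ∷ []) = answer verdict (header w) u v

  within : ∀ {m} {M : StackMachine m} {n k q ss b} → n ≤ k → Yields M n q ss b → Yields M k q ss b
  within {M = M} {n} {k} l y =
    subst (λ t → Yields M t _ _ _) (m∸n+n≡m l) (later M (k ∸ n) y)

  accepts-polyTime : ∀ verdict → PolyTime (accepts verdict)
  accepts-polyTime verdict =
    -- Every letter of the instance costs at most five steps; 9 collects the three constant steps of
    -- `setup` and the 6 of `time`.
    Simulation.polyTime (Program.machine circuits verdict) (con 5 ⊗ X ⊕ con 9) (accepts verdict)
      λ { (w ∷ u ∷ v ∷ []) → halts (header w) u v }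
    where
    open Program circuits verdict
    open Setup circuits verdict

    -- The slack is an explicit summand, which turns the inequality into an equation for the ring
    -- solver; r is the total length of the certificates.
    full-bound : ∀ n l r →
      n + 5 + 5 * r + (1 + (n * 3 + (1 + (suc n + (l * 5 + 6))))) ≡ 5 * (n + suc l + r) + 9
    full-bound = solve-∀

    bare-bound : ∀ n r → 2 * n + 7 + 5 * r + (1 + (n * 3 + 1)) ≡ 5 * (n + r) + 9
    bare-bound = solve-∀

    halts : ∀ {w} (h : Header w) u v →
      Runs (5 * size (w ∷ u ∷ v ∷ []) + 9) (running choose) (inputs machine (w ∷ u ∷ v ∷ []))
        (answer verdict h u v)
    halts (bare n) u v
      rewrite length-replicate n {x = I} =
      within (m+n≤o⇒n≤o _ (≤-reflexive (bare-bound n _))) (bare-rejects n u v)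
    halts (full n w) u v
      rewrite length-++ (unary n) {w} | length-++ (replicate n I) {O ∷ []} | length-replicate n {x = I}
        | +-assoc n 1 (length w) =
      within (m+n≤o⇒n≤o _ (≤-reflexive (full-bound n (length w) _)))
        (setup n u v (runs verdict w _ _ _))

  code : Σ ℕ Body → Word
  code (n , φ) = unary n ⁀ encode φ

  accepts-code : ∀ verdict {n} (φ : Body n) u v →
    accepts verdict (code (n , φ) ∷ u ∷ v ∷ []) ≡ checks verdict φ u v
  accepts-code verdict {n} φ u v
    rewrite header-unary n (encode φ) | complete φ = refl

  accepts-sound : ∀ verdict w u v → T (accepts verdict (w ∷ u ∷ v ∷ [])) → ∃[ i ] code i ≡ w
  accepts-sound verdict w u v = go (header w)
    where
    go : ∀ {w} (h : Header w) → T (answer verdict h u v) → ∃[ i ] code i ≡ w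
    go (full n w) t with just φ ← decoded n w in eq = (n , φ) , cong (unary n ⁀_) (sound w eq)

  Good : ∀ {n} → Body n → Vec Bool n → Set
  Good φ x = ∀ y z → T (holds φ x y z)

  Unique : Pred (Σ ℕ Body) 0ℓ
  Unique (n , φ) = ∃! _≡_ (Good φ)

  -- Subsets of a finite set are Boolean vectors, so `anySubset?` searches all y and z. The
  -- dichotomy later decides which of x and x′ is to be refuted.
  good⊎refuted : ∀ {n} (φ : Body n) x → Good φ x ⊎ ∃[ y ] ∃[ z ] holds φ x y z ≡ O
  good⊎refuted φ x with anySubset? (λ y → anySubset? (λ z → holds φ x y z ≟ O))
  ... | yes (y , z , h) = inj₂ (y , z , h)
  ... | no ¬h = inj₁ λ y z → holding y z
    where
    holding : ∀ y z → T (holds φ x y z)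
    holding y z with holds φ x y z in eq
    ... | O = ¬h (y , z , eq)
    ... | I = tt

  -- One bit for c and two for each of the n positions, where n is at most the length of the
  -- instance because the header is unary.
  bound : Poly
  bound = con 1 ⊕ X ⊗ con 2

  code-bound : ∀ {n} (φ : Body n) → n * 2 ≤ length (code (n , φ)) * 2
  code-bound {n} φ = *-monoˡ-≤ 2
    (subst (n ≤_) (sym (trans (length-++ (unary n)) (cong (_+ length (encode φ))
      (trans (length-++ (replicate n I)) (cong (_+ 1) (length-replicate n))))))
      (≤-trans (m≤m+n n 1) (m≤m+n (n + 1) _)))

  certificate : ∀ {n} (φ : Body n) (x x′ : Vec Bool n) →
    Σ (Vec Bool (⟦ bound ⟧ (length (code (n , φ))))) λ u → evens n (toList u) ≡ x × odds n (toList u) ≡ x′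
  certificate φ x x′ = interleave x x′ (≤-trans (code-bound φ) (n≤1+n _))

  -- Storing y reversed cancels the reversal made by the machine.
  witness : ∀ {n} (φ : Body n) c (y z : Vec Bool n) →
    Σ (Vec Bool (⟦ bound ⟧ (length (code (n , φ))))) λ v → ∀ verdict u →
      checks verdict φ u (toList v) ≡ check verdict φ (evens n u) (odds n u) c y z
  witness {n} φ c y z with interleave (Vec.reverse y) z (code-bound φ)
  ... | v , e , o = c ∷ v , λ verdict u →
    cong₂ (check verdict φ (evens n u) (odds n u) c)
      (trans (cong Vec.reverse e) (reverse-involutive y)) o

  exists-verdict unique-verdict : Bool → Bool → Bool
  exists-verdict e r = r
  unique-verdict e r = e ∨ not r

  -- `A₁` and `A₂` are taken to be the quantified conditions themselves, so their memberships are
  -- identities and the content is the equality with the intersection.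
  D₂-unique : ∀ {Yes : Pred (Σ ℕ Body) 0ℓ} → (∀ i → Yes i ⇔ Unique i) → ⟨ code ∣ Yes ⟩ ∈ D₂ᴾ
  D₂-unique {Yes} yes⇔unique =
    A₁ , A₂ ,
    (f₁ , accepts-polyTime exists-verdict , bound , λ w → mk⇔ id id) ,
    (f₂ , accepts-polyTime unique-verdict , bound , λ w → mk⇔ id id) ,
    (λ { (i , refl , y) → forth i (Equivalence.to (yes⇔unique i) y) }) , back
    where
    f₁ f₂ : Vec Word 3 → Bool
    f₁ = accepts exists-verdict
    f₂ = accepts unique-verdict

    A₁ A₂ : Language
    A₁ w = Σ (Vec Bool (⟦ bound ⟧ (length w))) λ u → (v : Vec Bool (⟦ bound ⟧ (length w))) →
           T (f₁ (w ∷ toList u ∷ toList v ∷ []))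
    A₂ w = (u : Vec Bool (⟦ bound ⟧ (length w))) → Σ (Vec Bool (⟦ bound ⟧ (length w))) λ v →
           T (f₂ (w ∷ toList u ∷ toList v ∷ []))

    refuting : ∀ {n} (φ : Body n) c (u : Vec Bool (⟦ bound ⟧ (length (code (n , φ))))) →
      let s = zipWith (choice c) (evens n (toList u)) (odds n (toList u)) in
      ∃[ y ] ∃[ z ] holds φ s y z ≡ O →
      Σ (Vec Bool _) λ v → T (f₂ (code (n , φ) ∷ toList u ∷ toList v ∷ []))
    refuting {n} φ c u (y , z , h) with witness φ c y z
    ... | v , e = v , subst T (sym (trans (accepts-code unique-verdict φ (toList u) (toList v)) (e unique-verdict (toList u)))) accepted
      where
      accepted : T (unique-verdict (agree (evens n (toList u)) (odds n (toList u)))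
        (holds φ (zipWith (choice c) (evens n (toList u)) (odds n (toList u))) y z))
      accepted with agree (evens n (toList u)) (odds n (toList u))
      ... | I = tt
      ... | O rewrite h = tt

    forth : ∀ i → Unique i → A₁ (code i) × A₂ (code i)
    forth (n , φ) (x , good , unique) = exists , atMostOne
      where
      exists : A₁ (code (n , φ))
      -- With x in both halves, the check concerns x whichever c comes with v.
      exists with certificate φ x x
      ... | u , e , o = u , λ v → subst T (sym (accepts-code exists-verdict φ (toList u) (toList v)))
        (subst (λ s → T (holds φ s _ _))
          (sym (trans (cong₂ (zipWith (choice (first-bit (toList v)))) e o) (choice-diagonal (first-bit (toList v)) x)))
          (good _ _))

      atMostOne : A₂ (code (n , φ))
      atMostOne u with ≡-dec _≟_ (evens n (toList u)) (odds n (toList u))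
      ... | yes e = Vec.replicate _ O ,
        subst T (sym (accepts-code unique-verdict φ (toList u) _)) (accepted (agree-≡ e) _)
        where
        accepted : ∀ {e} → e ≡ I → ∀ r → T (unique-verdict e r)
        accepted refl r = tt
      ... | no ≢ with good⊎refuted φ (evens n (toList u)) | good⊎refuted φ (odds n (toList u))
      ...   | inj₁ g | inj₁ g′ = ⊥-elim (≢ (trans (sym (unique g)) (unique g′)))
      ...   | inj₂ r | _       = refuting φ O u (subst (λ s → ∃[ y ] ∃[ z ] holds φ s y z ≡ O)
                                   (sym (choice-O (evens n (toList u)) (odds n (toList u)))) r)
      ...   | inj₁ _ | inj₂ r  = refuting φ I u (subst (λ s → ∃[ y ] ∃[ z ] holds φ s y z ≡ O)
                                   (sym (choice-I (evens n (toList u)) (odds n (toList u)))) r)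

    unique-from : ∀ {n} (φ : Body n) → A₁ (code (n , φ)) → A₂ (code (n , φ)) → Unique (n , φ)
    unique-from {n} φ (u , accepted) refutable = x , good , unique
      where
      x = evens n (toList u)

      good : Good φ x
      -- The two halves of u may differ; c = O singles out the first.
      good y z with witness φ O y z
      ... | v , e = subst (λ s → T (holds φ s y z)) (choice-O x (odds n (toList u)))
        (subst T (trans (accepts-code exists-verdict φ (toList u) (toList v)) (e exists-verdict (toList u)))
          (accepted v))

      unique : ∀ {x′} → Good φ x′ → x ≡ x′
      -- On the pair (x, x′) no v can refute R for either half, as both are good, so acceptance
      -- forces them to agree.
      unique {x′} good′ with certificate φ x x′
      ... | u′ , e , o with refutable u′
      ...   | v , t = agree⇒≡ x x′ (conclude c (subst T (trans (accepts-code unique-verdict φ (toList u′) (toList v))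
                         (cong₂ (λ x x′ → check unique-verdict φ x x′ c y z) e o)) t))
        where
        c = first-bit (toList v)
        y = Vec.reverse (evens n (List.drop 1 (toList v)))
        z = odds n (List.drop 1 (toList v))

        conclude : ∀ c → T (check unique-verdict φ x x′ c y z) → T (agree x x′)
        conclude O t rewrite choice-O x x′ | Equivalence.to T-≡ (good y z) with agree x x′
        ... | I = tt
        conclude I t rewrite choice-I x x′ | Equivalence.to T-≡ (good′ y z) with agree x x′
        ... | I = tt

    back : ∀ {w} → A₁ w × A₂ w → ⟨ code ∣ Yes ⟩ w
    back {w} (a₁@(u , accepted) , a₂)
      -- Acceptance with any one v already shows that the word parses.
      with accepts-sound exists-verdict w (toList u) _ (accepted (Vec.replicate _ O))
    ... | (n , φ) , refl = (n , φ) , refl , Equivalence.from (yes⇔unique (n , φ)) (unique-from φ a₁ a₂)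

-- The satisfiability problem.

satProblem : Problem
satProblem = record
  { Body     = λ n → Formula (n + n)
  ; encode   = encodeF
  ; decoded  = λ n w → formula w []
  ; complete = λ φ → subst (λ w → formula w [] ≡ just φ) (++-identityʳ (encodeF φ)) (formula-encode φ [] [])
  ; sound    = λ w e → sym (formula-sound w [] e)
  ; holds    = λ ψ x y z → evalF ψ (x ++ y)
  ; circuits = O
  ; runs     = λ verdict w x y z {U} {V} {K} {D} l → FormulaRun.formula-run verdict (x ++ y) (z ++ y) U V K D w []
  }

sat⇔unique : ∀ i → UniqueSat i ⇔ Unique satProblem i
sat⇔unique (n , ψ) = mk⇔
  (λ (x , valid , unique) → x , (λ y z → Equivalence.from T-≡ (valid y)) ,
    λ good → unique λ y → Equivalence.to T-≡ (good y y))
  (λ (x , good , unique) → x , (λ y → Equivalence.to T-≡ (good y y)) ,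
    λ valid → unique λ y z → Equivalence.from T-≡ (valid y))

-- Comparison of payoffs and weak dominance.

double : ℕ → Bool → ℕ
double a b = 2 * a + (if b then 1 else 0)

double-< : ∀ {p q} → p < q → ∀ a b → double p a < double q b
double-< {p} {q} p<q a b = begin-strict
  double p a  ≤⟨ +-monoʳ-≤ (2 * p) (bit≤1 a) ⟩
  2 * p + 1   <⟨ ≤-reflexive (suc-double p) ⟩
  2 * suc p   ≤⟨ *-monoʳ-≤ 2 p<q ⟩
  2 * q       ≤⟨ m≤m+n (2 * q) _ ⟩
  double q b  ∎
  where
  open ≤-Reasoning
  bit≤1 : ∀ a → (if a then 1 else 0) ≤ 1
  bit≤1 O = z≤n
  bit≤1 I = ≤-refl
  suc-double : ∀ p → suc (2 * p + 1) ≡ 2 * suc p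
  suc-double = solve-∀

-- `value` with the number read so far as accumulator, which the induction on the remaining bits
-- needs.
valueFrom : ∀ {n} → ℕ → Vec Bool n → ℕ
valueFrom = Vec.foldl (λ _ → ℕ) double

valueFrom-< : ∀ {n p q} (x y : Vec Bool n) → p < q → valueFrom p x < valueFrom q y
valueFrom-< []      []      l = l
valueFrom-< (a ∷ x) (b ∷ y) l = valueFrom-< x y (double-< l a b)

dominates-decided : ∀ {n} r (x y : Vec Bool n) → dominates I r x y ≡ r
dominates-decided r []      []      = refl
dominates-decided r (a ∷ x) (b ∷ y) = dominates-decided r x y

-- As long as the bits agree, both numbers share the accumulator p. At the first difference the
-- accumulators become strictly ordered, and by `valueFrom-<` no later bits can change that.
dominates⇔≥ : ∀ {n} p (x y : Vec Bool n) → T (dominates O I x y) ⇔ valueFrom p x ≥ valueFrom p y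
dominates⇔≥ p []      []      = mk⇔ (λ _ → ≤-refl) (λ _ → tt)
dominates⇔≥ p (O ∷ x) (O ∷ y) = dominates⇔≥ (double p O) x y
dominates⇔≥ p (I ∷ x) (I ∷ y) = dominates⇔≥ (double p I) x y
dominates⇔≥ p (O ∷ x) (I ∷ y) rewrite dominates-decided O x y =
  mk⇔ (λ ()) (<⇒≱ (valueFrom-< x y (+-monoʳ-< (2 * p) (s≤s z≤n))))
dominates⇔≥ p (I ∷ x) (O ∷ y) rewrite dominates-decided I x y =
  mk⇔ (λ _ → <⇒≤ (valueFrom-< y x (+-monoʳ-< (2 * p) (s≤s z≤n)))) (λ _ → tt)

toCircuit : ∀ {i o} → Parsed {o} gates i → Circuit i o
toCircuit (_ , gs , os) = circuit gs os

dominatesC : ∀ {n} → Circuit (n + n) n → (x y z : Vec Bool n) → Bool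
dominatesC C x y z = dominates O I (evalC C (x ++ y)) (evalC C (z ++ y))

circuitProblem : Problem
circuitProblem = record
  { Body     = λ n → Circuit (n + n) n
  ; encode   = λ C → encodeGs (Circuit.gates C) ⁀ encodeOs (Circuit.outputs C)
  ; decoded  = λ n w → Maybe.map toCircuit (parse gates (n + n) w)
  ; complete = λ C → cong (Maybe.map toCircuit) (parse-gates (Circuit.gates C) (Circuit.outputs C))
  ; sound    = λ w → sound w _
  ; holds    = dominatesC
  ; circuits = I
  ; runs     = λ verdict {n} w x y z {U} {V} {K} {D} l →
      subst (Program.Runs I verdict _ _ _)
        (fuse verdict D x y z (parse gates (n + n) w))
        (CircuitRun.gates-run verdict n U V D w (x ++ y) (z ++ y) O I K l)
  }
  where
  sound : ∀ {n} w (C : Circuit (n + n) n) → Maybe.map toCircuit (parse gates (n + n) w) ≡ just C →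
          encodeGs (Circuit.gates C) ⁀ encodeOs (Circuit.outputs C) ≡ w
  sound {n} w C e with just p ← parse {n} gates (n + n) w in eq | refl ← e
    = sym (parse-sound gates (n + n) w eq)

  fuse : ∀ verdict D {n} (x y z : Vec Bool n) m →
    CircuitRun.outcome verdict n [] [] D gates O I (x ++ y) (z ++ y) m ≡
    maybe′ (λ C → verdict (is-nothing (List.head D)) (dominatesC C x y z)) O (Maybe.map toCircuit m)
  fuse verdict D x y z nothing  = refl
  fuse verdict D x y z (just _) = refl

dominant⇔unique : ∀ i → WeaklyDominant i ⇔ Unique circuitProblem i
dominant⇔unique (n , C) = mk⇔ to from
  where
  payoff : Vec Bool n → Vec Bool n → ℕ
  payoff a b = value (evalC C (a ++ b))

  NeverWorse : Vec Bool n → Set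
  NeverWorse x = ∀ y z → payoff x y ≥ payoff z y

  good : ∀ {x} → NeverWorse x → Good circuitProblem C x
  good h y z = Equivalence.from (dominates⇔≥ 0 (evalC C (_ ++ y)) (evalC C (z ++ y))) (h y z)

  neverWorse : ∀ {x} → Good circuitProblem C x → NeverWorse x
  neverWorse h y z = Equivalence.to (dominates⇔≥ 0 (evalC C (_ ++ y)) (evalC C (z ++ y))) (h y z)

  to : WeaklyDominant (n , C) → Unique circuitProblem (n , C)
  to (x , dominant) = x , good never , λ {x′} → unique x′
    where
    never : NeverWorse x
    never y z with ≡-dec _≟_ z x
    ... | yes refl = ≤-refl
    ... | no z≢x   = proj₁ (proj₂ (dominant z y z≢x))

    unique : ∀ x′ → Good circuitProblem C x′ → x ≡ x′
    unique x′ good′ with ≡-dec _≟_ x′ x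
    ... | yes refl  = refl
    -- The argument x stands for an arbitrary y: only the strict inequality, which comes with its
    -- own y′, is used.
    ... | no  x′≢x with dominant x′ x x′≢x
    ...   | y , _ , better = ⊥-elim (<⇒≱ better (neverWorse good′ y x))

  from : Unique circuitProblem (n , C) → WeaklyDominant (n , C)
  from (x , good-x , unique) = x , strictly
    where
    never : NeverWorse x
    never = neverWorse good-x

    strictly : ∀ x′ y → x′ ≢ x →
               Σ (Vec Bool n) λ y′ → payoff x y ≥ payoff x′ y × payoff x y′ > payoff x′ y′
    strictly x′ y x′≢x with anySubset? (λ y′ → payoff x′ y′ <? payoff x y′)
    ... | yes (y′ , better) = y′ , never y x′ , better
    -- Otherwise x′ does at least as well as x against every y, hence is never worse than any z
    -- either, contradicting uniqueness.
    ... | no ¬better = ⊥-elim (x′≢x (sym (unique (good λ y z →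
            ≤-trans (never y z) (≮⇒≥ λ better → ¬better (y , better))))))

theorem8p3 : (U∃∀-Sat ∈ D₂ᴾ) × (WDom-Strategy ∈ D₂ᴾ)
theorem8p3 = D₂-unique satProblem sat⇔unique , D₂-unique circuitProblem dominant⇔unique
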